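{- For every integer $n\geq1$, $$\gamma(5n+1)+2\gamma(5n+2)+3\gamma(5n+3)+4\gamma(5n+4)\equiv0\pmod5.$$
   Context: A nuclear partition is an integer partition with no part equal to $1$. $\gamma(n)$ denotes the number of nuclear partitions $\mu=(\mu_1,\mu_2,\dots,\mu_r)$ of $n$, with $\mu_1\geq\mu_2\geq\dots\geq\mu_r\geq2$ and $r\geq2$, such that $\mu_1=\mu_2$ (so the two largest parts are equal). -}

module Defs where

open import Data.Empty using (⊥)
open import Data.List.Base using (List; []; _∷_; _++_; map; filter; length; [_])
open import Data.List.Membership.Propositional using (_∈_)
open import Data.List.Membership.Propositional.Properties
  using (∈-map⁺; ∈-map⁻; ∈-++⁺ˡ; ∈-++⁺ʳ; ∈-++⁻; ∈-filter⁺; ∈-filter⁻)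
open import Data.List.Properties using (∷-injectiveʳ)
open import Data.List.Relation.Unary.All using (All; []; _∷_; all?)
open import Data.List.Relation.Unary.Any using (here)
open import Data.List.Relation.Unary.Linked using (Linked; []; [-]; _∷_)
open import Data.List.Relation.Unary.Unique.Propositional using (Unique; []; _∷_)
import Data.List.Relation.Unary.Unique.Propositional.Properties as Unique
open import Data.Nat using (ℕ; zero; suc; _+_; _∸_; _≤_; _≥_; z≤n; s≤s; _≤?_; _≟_)
open import Data.Nat.ListAction using (sum)
open import Data.Nat.Properties
open import Data.Product using (_×_; _,_; proj₂)
open import Data.Sum using (inj₁; inj₂)
open import Function.Bundles using (_⇔_; mk⇔)
open import Relation.Binary.PropositionalEquality hiding ([_])
open import Relation.Nullary using (¬_; yes; no; contradiction)
open import Relation.Nullary.Decidable using (¬?; _×-dec_)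
open import Relation.Unary using (Decidable)

record IsPartition (n : ℕ) (μ : List ℕ) : Set where
  constructor mkIsPartition
  field
    decreasing : Linked _≥_ μ
    positive   : All (1 ≤_) μ
    sums       : sum μ ≡ n

IsNuclear : List ℕ → Set
IsNuclear = All (λ part → ¬ (part ≡ 1))

-- In a weakly decreasing list the first two entries are the two largest parts;
-- lists with fewer than two parts do not qualify.
EqualLargestTwo : List ℕ → Set
EqualLargestTwo (a ∷ b ∷ _) = a ≡ b
EqualLargestTwo _           = ⊥

isNuclear? : Decidable IsNuclear
isNuclear? = all? (λ part → ¬? (part ≟ 1))

equalLargestTwo? : Decidable EqualLargestTwo
equalLargestTwo? []          = no λ ()
equalLargestTwo? (_ ∷ [])    = no λ ()
equalLargestTwo? (a ∷ b ∷ _) = a ≟ b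

-- The partitions of n with at most ℓ parts, all of them ≤ m.  In the last clause
-- the largest part is either equal to suc m or at most m.
boundedPartitions : (ℓ m n : ℕ) → List (List ℕ)
boundedPartitions ℓ       m       zero    = [ [] ]
boundedPartitions zero    m       (suc n) = []
boundedPartitions (suc ℓ) zero    (suc n) = []
boundedPartitions (suc ℓ) (suc m) (suc n) with m ≤? n
... | yes _ = map (suc m ∷_) (boundedPartitions ℓ (suc m) (n ∸ m))
              ++ boundedPartitions (suc ℓ) m (suc n)
... | no _  = boundedPartitions (suc ℓ) m (suc n)

-- See ∈-partitions and partitions-unique below: this lists every partition of n
-- exactly once.
partitions : ℕ → List (List ℕ)
partitions n = boundedPartitions n n n

γ-partitions : ℕ → List (List ℕ)
γ-partitions n =
  filter (λ μ → isNuclear? μ ×-dec equalLargestTwo? μ) (partitions n)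

γ : ℕ → ℕ
γ n = length (γ-partitions n)

-- Linked _≥_ (m ∷ μ) says that μ is weakly decreasing with all parts ≤ m.

private
  tail-linked : ∀ {m μ} → Linked _≥_ (m ∷ μ) → Linked _≥_ μ
  tail-linked [-]     = []
  tail-linked (_ ∷ l) = l

  relax : ∀ {m k μ} → m ≤ k → Linked _≥_ (m ∷ μ) → Linked _≥_ (k ∷ μ)
  relax m≤k [-]       = [-]
  relax m≤k (x≤m ∷ l) = ≤-trans x≤m m≤k ∷ l

  length≤sum : ∀ {μ} → All (1 ≤_) μ → length μ ≤ sum μ
  length≤sum []       = z≤n
  length≤sum (p ∷ ps) = +-mono-≤ p (length≤sum ps)

  linked-sum : ∀ {μ} → Linked _≥_ μ → Linked _≥_ (sum μ ∷ μ)
  linked-sum {[]}    _ = [-]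
  linked-sum {x ∷ μ} l = m≤m+n x (sum μ) ∷ l

boundedPartitions-sound : ∀ ℓ m n {μ} → μ ∈ boundedPartitions ℓ m n →
  Linked _≥_ (m ∷ μ) × IsPartition n μ
boundedPartitions-sound ℓ m zero (here refl) = [-] , mkIsPartition [] [] refl
boundedPartitions-sound (suc ℓ) (suc m) (suc n) μ∈ with m ≤? n
... | no _ with boundedPartitions-sound (suc ℓ) m (suc n) μ∈
...   | l , p = relax (n≤1+n m) l , p
boundedPartitions-sound (suc ℓ) (suc m) (suc n) μ∈ | yes m≤n
    with ∈-++⁻ (map (suc m ∷_) (boundedPartitions ℓ (suc m) (n ∸ m))) μ∈
... | inj₂ ν∈ with boundedPartitions-sound (suc ℓ) m (suc n) ν∈
...   | l , p = relax (n≤1+n m) l , p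
boundedPartitions-sound (suc ℓ) (suc m) (suc n) μ∈ | yes m≤n | inj₁ ν∈
    with ∈-map⁻ (suc m ∷_) ν∈
... | ν , ν∈′ , refl with boundedPartitions-sound ℓ (suc m) (n ∸ m) ν∈′
...   | l , mkIsPartition _ pos s =
  ≤-refl ∷ l ,
  mkIsPartition l (s≤s z≤n ∷ pos) (cong suc (trans (cong (m +_) s) (m+[n∸m]≡n m≤n)))

boundedPartitions-complete : ∀ ℓ m n {μ} → Linked _≥_ (m ∷ μ) → length μ ≤ ℓ →
  IsPartition n μ → μ ∈ boundedPartitions ℓ m n
boundedPartitions-complete ℓ m zero {[]} l len p = here refl
boundedPartitions-complete ℓ m zero {zero ∷ μ} l len (mkIsPartition _ (() ∷ _) _)
boundedPartitions-complete ℓ m (suc n) {[]} l len (mkIsPartition _ _ ())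
boundedPartitions-complete (suc ℓ) zero (suc n) {zero ∷ μ} l len (mkIsPartition _ (() ∷ _) _)
boundedPartitions-complete (suc ℓ) zero (suc n) {suc x ∷ μ} (() ∷ _) len p
boundedPartitions-complete (suc ℓ) (suc m) (suc n) {x ∷ μ} (x≤ ∷ l) (s≤s len)
    p@(mkIsPartition _ (_ ∷ pos) s) with x ≟ suc m | m ≤? n
... | no x≢ | no _ =
  boundedPartitions-complete (suc ℓ) m (suc n)
    (≤-pred (≤∧≢⇒< x≤ x≢) ∷ l) (s≤s len) p
... | no x≢ | yes _ =
  ∈-++⁺ʳ _ (boundedPartitions-complete (suc ℓ) m (suc n)
             (≤-pred (≤∧≢⇒< x≤ x≢) ∷ l) (s≤s len) p)
... | yes refl | no m≰n =
  contradiction (subst (m ≤_) (suc-injective s) (m≤m+n m (sum μ))) m≰n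
... | yes refl | yes _ =
  ∈-++⁺ˡ (∈-map⁺ (suc m ∷_) (boundedPartitions-complete ℓ (suc m) (n ∸ m) l len
    (mkIsPartition (tail-linked l) pos
      (trans (sym (m+n∸m≡n m (sum μ))) (cong (_∸ m) (suc-injective s))))))

boundedPartitions-unique : ∀ ℓ m n → Unique (boundedPartitions ℓ m n)
boundedPartitions-unique ℓ       m       zero    = [] ∷ []
boundedPartitions-unique zero    m       (suc n) = []
boundedPartitions-unique (suc ℓ) zero    (suc n) = []
boundedPartitions-unique (suc ℓ) (suc m) (suc n) with m ≤? n
... | no _  = boundedPartitions-unique (suc ℓ) m (suc n)
... | yes _ = Unique.++⁺
  (Unique.map⁺ ∷-injectiveʳ (boundedPartitions-unique ℓ (suc m) (n ∸ m)))
  (boundedPartitions-unique (suc ℓ) m (suc n))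
  disjoint
  where
  disjoint : ∀ {μ} → ¬ (μ ∈ map (suc m ∷_) (boundedPartitions ℓ (suc m) (n ∸ m)) ×
                        μ ∈ boundedPartitions (suc ℓ) m (suc n))
  disjoint (μ∈ , μ∈′) with ∈-map⁻ (suc m ∷_) μ∈
  ... | _ , _ , refl with boundedPartitions-sound (suc ℓ) m (suc n) μ∈′
  ...   | 1+m≤m ∷ _ , _ = 1+n≰n 1+m≤m

∈-partitions : ∀ {n μ} → μ ∈ partitions n ⇔ IsPartition n μ
∈-partitions {n} {μ} = mk⇔ (λ μ∈ → proj₂ (boundedPartitions-sound n n n μ∈)) to-∈
  where
  to-∈ : IsPartition n μ → μ ∈ partitions n
  to-∈ p@(mkIsPartition l pos refl) =
    boundedPartitions-complete n n n (linked-sum l) (length≤sum pos) p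

partitions-unique : ∀ n → Unique (partitions n)
partitions-unique n = boundedPartitions-unique n n n

{-# OPTIONS --safe #-}

-- Let p(n) be the number of partitions and ν(n) = p(n) − p(n − 1) the number of nuclear
-- partitions of n.  Lowering the largest part gives γ(n) = ν(n) − ν(n − 1) for n ≥ 3, so
-- modulo 5 the sum telescopes to p(5n − 1) − p(5n + 4), and Ramanujan's congruence
-- 5 ∣ p(5n + 4) remains.  Write θ = q d/dq, p = Σ p(n) qⁿ and σₖ for the series of
-- divisor power sums.  Then θp = σ₁ p and 12 σ₁² = 5 σ₃ + σ₁ − 6 θσ₁, the latter by a
-- trichotomy on the solutions of a x + b y = n.  By induction on k,
-- 6 θ(σ₁ᵏ p) ≡ k σ₁ᵏ p + (6 − 12 k) σ₁ᵏ⁺¹ p (mod 5); at an exponent ≡ 4 (mod 5) this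
-- makes the coefficients of σ₁³ p, σ₁² p, σ₁ p and p divisible by 5, in this order.

module Submission where

open import Defs
open import Algebra.Bundles using (AbelianGroup)
open import Data.Integer using (ℤ; +_; 0ℤ; 1ℤ)
import Data.Integer.Divisibility.Signed as ℤ∣
import Data.Integer.Properties as ℤₚ
open import Data.Integer.Tactic.RingSolver using (solve-∀)
open import Data.List.Base using (List; []; _∷_; _++_; map; filter; length)
open import Data.List.Membership.Propositional using (_∈_)
open import Data.List.Properties
  using (length-++; length-map; filter-++; filter-none; map-++; map-∘)
open import Data.List.Relation.Unary.All using (All; []; _∷_; tabulate)
import Data.List.Relation.Unary.All.Properties as All
open import Data.List.Relation.Unary.Linked using (_∷_)
open import Data.Nat as ℕ using (ℕ; zero; suc; _∸_; _<_; z≤n; s≤s; _≤?_)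
import Data.Nat.Properties as ℕₚ
import Data.Nat.Tactic.RingSolver as ℕ-Solver
open import Data.Product using (_×_; _,_)
open import Function.Base using (_∘_; flip)
open import Function.Bundles using (_⇔_; mk⇔; Equivalence)
open import Level using (0ℓ)
open import Relation.Binary.PropositionalEquality
open import Relation.Nullary using (¬_; yes; no; contradiction)
open import Relation.Nullary.Decidable using (_×-dec_)
open import Relation.Unary using (Pred; Decidable)
open import Algebra.Properties.Group (AbelianGroup.group ℤₚ.+-0-abelianGroup)
  using (∙-cancelʳ)

open import Data.Nat using (_≤_)
open import Data.Nat.Divisibility using (_∣_)
open ≡-Reasoning

-- The residue 4 is forced by the descent. On exponents congruent to r modulo 5 the operator 6θ acts
-- as multiplication by r, so the equation for σ₁ᵏ p carries the factor r - k, which has to be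
-- invertible for k = 0, 1, 2, 3. The chain can start at k = 3 only because 6 - 12 · 3 = -30 removes
-- σ₁⁴ p. The relation for σ₁² is Ramanujan's 12 θP = P² - Q with P = 1 - 24 σ₁ and Q = 1 + 240 σ₃.
-- Its only term outside the powers of σ₁ and θσ₁ has coefficient 5, so modulo 5 the span of the σ₁ᵏ
-- p is closed under θ. Series are bare coefficient functions, without limits or division. Infinite
-- products are truncated at a largest part m. Passing from m - 1 to d = m gives equations F = R +
-- qᵈ F, and uniqueness of their solution replaces division by 1 - qᵈ. Congruences are carried as
-- integer identities with an explicit multiple of 5.

-- Within this module + and * are the operations of ℤ.
module _ where

  open import Data.Integer using (_+_; _*_; _-_; -_)

  -- Finite sums

  ∑ : ℕ → (ℕ → ℤ) → ℤ
  ∑ zero    f = 0ℤ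
  ∑ (suc n) f = f 0 + ∑ n (f ∘ suc)

  infixr 6.5 ∑-syntax
  ∑-syntax : ℕ → (ℕ → ℤ) → ℤ
  ∑-syntax = ∑
  syntax ∑-syntax n (λ i → e) = ∑[ i < n ] e

  ∑-snoc : ∀ n f → ∑ (suc n) f ≡ ∑ n f + f n
  ∑-snoc zero    f = ℤₚ.+-comm (f 0) 0ℤ
  ∑-snoc (suc n) f = trans (cong (_+_ (f 0)) (∑-snoc n (f ∘ suc))) (sym (ℤₚ.+-assoc (f 0) _ _))

  ∑-cong : ∀ n {f g : ℕ → ℤ} → f ≗ g → ∑ n f ≡ ∑ n g
  ∑-cong zero    f≗g = refl
  ∑-cong (suc n) f≗g = cong₂ _+_ (f≗g 0) (∑-cong n (f≗g ∘ suc))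

  ∑-zero : ∀ n {f : ℕ → ℤ} → (∀ i → f i ≡ 0ℤ) → ∑ n f ≡ 0ℤ
  ∑-zero zero    f≡0 = refl
  ∑-zero (suc n) f≡0 = cong₂ _+_ (f≡0 0) (∑-zero n (f≡0 ∘ suc))

  ∑-+ : ∀ n (f g : ℕ → ℤ) → ∑ n (λ i → f i + g i) ≡ ∑ n f + ∑ n g
  ∑-+ zero    f g = refl
  ∑-+ (suc n) f g = trans (cong (_+_ (f 0 + g 0)) (∑-+ n (f ∘ suc) (g ∘ suc)))
                          (interchange (f 0) (g 0) _ _)
    where
    interchange : ∀ a b c d → (a + b) + (c + d) ≡ (a + c) + (b + d)
    interchange = solve-∀

  ∑-*ˡ : ∀ n c (f : ℕ → ℤ) → ∑ n (λ i → c * f i) ≡ c * ∑ n f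
  ∑-*ˡ zero    c f = sym (ℤₚ.*-zeroʳ c)
  ∑-*ˡ (suc n) c f = trans (cong (_+_ (c * f 0)) (∑-*ˡ n c (f ∘ suc)))
                           (sym (ℤₚ.*-distribˡ-+ c (f 0) _))

  ∑-const : ∀ n c → ∑ n (λ _ → c) ≡ + n * c
  ∑-const zero    c = refl
  ∑-const (suc n) c = trans (cong (_+_ c) (∑-const n c)) (sym (ℤₚ.suc-* (+ n) c))

  ∑-swap : ∀ m n (f : ℕ → ℕ → ℤ) →
    ∑[ i < m ] ∑[ j < n ] f i j ≡ ∑[ j < n ] ∑[ i < m ] f i j
  ∑-swap zero    n f = sym (∑-zero n (λ _ → refl))
  ∑-swap (suc m) n f = trans (cong (_+_ (∑ n (f 0))) (∑-swap m n (f ∘ suc)))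
                             (sym (∑-+ n (f 0) _))

  ∑-extend : ∀ {m n} {f : ℕ → ℤ} → m ≤ n → (∀ i → m ≤ i → f i ≡ 0ℤ) → ∑ n f ≡ ∑ m f
  ∑-extend {n = n} z≤n       f≡0 = ∑-zero n (λ i → f≡0 i z≤n)
  ∑-extend {f = f} (s≤s m≤n) f≡0 =
    cong (_+_ (f 0)) (∑-extend m≤n (λ i m≤i → f≡0 (suc i) (s≤s m≤i)))

  ∑² : ℕ → (ℕ → ℕ → ℤ) → ℤ
  ∑² n f = ∑[ i < n ] ∑[ j < n ] f i j

  ∑²-syntax : ℕ → (ℕ → ℕ → ℤ) → ℤ
  ∑²-syntax = ∑²
  infixr 6.5 ∑²-syntax
  syntax ∑²-syntax n (λ i j → e) = ∑²[ i , j < n ] e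

  ∑²-cong : ∀ n {f g : ℕ → ℕ → ℤ} → (∀ i j → f i j ≡ g i j) → ∑² n f ≡ ∑² n g
  ∑²-cong n f≡g = ∑-cong n (λ i → ∑-cong n (f≡g i))

  ∑²-zero : ∀ n {f : ℕ → ℕ → ℤ} → (∀ i j → f i j ≡ 0ℤ) → ∑² n f ≡ 0ℤ
  ∑²-zero n f≡0 = ∑-zero n (λ i → ∑-zero n (f≡0 i))

  ∑²-+ : ∀ n (f g : ℕ → ℕ → ℤ) → ∑² n (λ i j → f i j + g i j) ≡ ∑² n f + ∑² n g
  ∑²-+ n f g = trans (∑-cong n (λ i → ∑-+ n (f i) (g i))) (∑-+ n _ _)

  ∑²-*ˡ : ∀ n c (f : ℕ → ℕ → ℤ) → ∑² n (λ i j → c * f i j) ≡ c * ∑² n f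
  ∑²-*ˡ n c f = trans (∑-cong n (λ i → ∑-*ˡ n c (f i))) (∑-*ˡ n c _)

  ∑²-transpose : ∀ n (f : ℕ → ℕ → ℤ) → ∑² n f ≡ ∑² n (flip f)
  ∑²-transpose n f = ∑-swap n n f

  ∑-∑²-swap : ∀ n (f : ℕ → ℕ → ℕ → ℤ) →
    ∑[ i < n ] ∑² n (f i) ≡ ∑²[ j , k < n ] ∑[ i < n ] f i j k
  ∑-∑²-swap n f = trans (∑-swap n n _) (∑-cong n (λ j → ∑-swap n n (λ i → f i j)))

  ∑²-swap : ∀ n (f : ℕ → ℕ → ℕ → ℕ → ℤ) →
    ∑²[ i , j < n ] ∑² n (f i j) ≡ ∑²[ k , l < n ] ∑²[ i , j < n ] f i j k l
  ∑²-swap n f = trans (∑-cong n (λ i → ∑-∑²-swap n (f i))) (∑-∑²-swap n _)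

  -- Row 0 and column 0 are peeled off the square: the corner joins the diagonal, the two edges are
  -- the pairs at distance `suc k` from index 0, and the remaining square is smaller by one.
  ∑²-trichotomy-∸ : ∀ n (f : ℕ → ℕ → ℤ) → ∑² n f ≡
    ∑[ i < n ] f i i +
    ∑[ i < n ] ∑[ k < n ∸ suc i ] (f (suc (i ℕ.+ k)) i + f i (suc (i ℕ.+ k)))
  ∑²-trichotomy-∸ zero    f = refl
  ∑²-trichotomy-∸ (suc n) f = begin
    (f 0 0 + row) + ∑[ i < n ] (f (suc i) 0 + ∑[ j < n ] f (suc i) (suc j))
      ≡⟨ cong (_+_ (f 0 0 + row)) (∑-+ n _ _) ⟩
    (f 0 0 + row) + (col + ∑² n (λ i j → f (suc i) (suc j)))
      ≡⟨ cong (λ s → (f 0 0 + row) + (col + s)) (∑²-trichotomy-∸ n _) ⟩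
    (f 0 0 + row) + (col + (diag + off))
      ≡⟨ rearrange (f 0 0) row col diag off ⟩
    (f 0 0 + diag) + ((col + row) + off)
      ≡⟨ cong (λ s → (f 0 0 + diag) + (s + off)) (∑-+ n _ _) ⟨
    (f 0 0 + diag) + (∑[ k < n ] (f (suc k) 0 + f 0 (suc k)) + off) ∎
    where
    row col diag off : ℤ
    row  = ∑[ j < n ] f 0 (suc j)
    col  = ∑[ i < n ] f (suc i) 0
    diag = ∑[ i < n ] f (suc i) (suc i)
    off  = ∑[ i < n ] ∑[ k < n ∸ suc i ]
             (f (suc (suc (i ℕ.+ k))) (suc i) + f (suc i) (suc (suc (i ℕ.+ k))))
    rearrange : ∀ o r c d e → (o + r) + (c + (d + e)) ≡ (o + d) + ((c + r) + e)
    rearrange = solve-∀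

  ∑-∸-extend : ∀ n (f : ℕ → ℕ → ℤ) → (∀ i j → n ≤ j → f i j ≡ 0ℤ) →
    ∑²[ i , k < n ] f i (suc (i ℕ.+ k)) ≡ ∑[ i < n ] ∑[ k < n ∸ suc i ] f i (suc (i ℕ.+ k))
  ∑-∸-extend n f f≡0 = ∑-cong n λ i → ∑-extend (ℕₚ.m∸n≤m n (suc i))
    (λ k n∸i≤k → f≡0 i _ (ℕₚ.≤-trans (ℕₚ.m≤n+m∸n n (suc i)) (ℕₚ.+-monoʳ-≤ (suc i) n∸i≤k)))

  -- Vanishing outside the square lets the gap `k` range independently of `i`. The off-diagonal
  -- parts are then again sums over full squares, which can be exchanged and compared term by term.
  ∑²-trichotomy : ∀ n (f : ℕ → ℕ → ℤ) →
    (∀ i j → n ≤ i → f i j ≡ 0ℤ) → (∀ i j → n ≤ j → f i j ≡ 0ℤ) →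
    ∑² n f ≡ ∑[ i < n ] f i i +
      (∑²[ i , k < n ] f (suc (i ℕ.+ k)) i + ∑²[ i , k < n ] f i (suc (i ℕ.+ k)))
  ∑²-trichotomy n f left right = begin
    ∑² n f
      ≡⟨ ∑²-trichotomy-∸ n f ⟩
    diag + ∑[ i < n ] ∑[ k < n ∸ suc i ] (f (suc (i ℕ.+ k)) i + f i (suc (i ℕ.+ k)))
      ≡⟨ cong (_+_ diag) (trans (∑-cong n (λ i → ∑-+ (n ∸ suc i) _ _)) (∑-+ n _ _)) ⟩
    diag + (∑[ i < n ] ∑[ k < n ∸ suc i ] f (suc (i ℕ.+ k)) i +
            ∑[ i < n ] ∑[ k < n ∸ suc i ] f i (suc (i ℕ.+ k)))
      ≡⟨ cong (_+_ diag) (cong₂ _+_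
           (∑-∸-extend n (flip f) (λ i j → left j i))
           (∑-∸-extend n f right)) ⟨
    diag + (∑²[ i , k < n ] f (suc (i ℕ.+ k)) i + ∑²[ i , k < n ] f i (suc (i ℕ.+ k))) ∎
    where
    diag : ℤ
    diag = ∑[ i < n ] f i i

  ∑-triangle : ∀ n (f : ℕ → ℕ → ℤ) →
    ∑[ i < n ] ∑[ k < n ∸ suc i ] f i (suc (i ℕ.+ k)) ≡ ∑[ j < n ] ∑[ i < j ] f i j
  ∑-triangle zero    f = refl
  ∑-triangle (suc n) f = begin
    ∑[ k < n ] f 0 (suc k) + ∑[ i < n ] ∑[ k < n ∸ suc i ] f (suc i) (suc (suc (i ℕ.+ k)))
      ≡⟨ cong (_+_ (∑[ k < n ] f 0 (suc k))) (∑-triangle n (λ i j → f (suc i) (suc j))) ⟩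
    ∑[ k < n ] f 0 (suc k) + ∑[ j < n ] ∑[ i < j ] f (suc i) (suc j)
      ≡⟨ ∑-+ n _ _ ⟨
    ∑[ j < n ] (f 0 (suc j) + ∑[ i < j ] f (suc i) (suc j))
      ≡⟨ ℤₚ.+-identityˡ _ ⟨
    0ℤ + ∑[ j < n ] (f 0 (suc j) + ∑[ i < j ] f (suc i) (suc j)) ∎

  -- Formal power series

  Series : Set
  Series = ℕ → ℤ

  -- The monomial qᵏ.
  δ : ℕ → Series
  δ zero    zero    = 1ℤ
  δ zero    (suc n) = 0ℤ
  δ (suc k) zero    = 0ℤ
  δ (suc k) (suc n) = δ k n

  δ-> : ∀ {k n} → n < k → δ k n ≡ 0ℤ
  δ-> {suc k} {zero}  _         = refl
  δ-> {suc k} {suc n} (s≤s n<k) = δ-> n<k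

  -- The factor `δ k n` is zero unless `k` is `n`. This later trades a product of a divisor and its
  -- cofactor for the exponent itself, which is how θ enters.
  δ-diag : ∀ k n (f : ℕ → ℤ) → δ k n * f k ≡ δ k n * f n
  δ-diag zero    zero    f = refl
  δ-diag zero    (suc n) f = trans (ℤₚ.*-zeroˡ (f 0)) (sym (ℤₚ.*-zeroˡ (f (suc n))))
  δ-diag (suc k) zero    f = trans (ℤₚ.*-zeroˡ (f (suc k))) (sym (ℤₚ.*-zeroˡ (f 0)))
  δ-diag (suc k) (suc n) f = δ-diag k n (f ∘ suc)

  -- Multiplication by qᵈ.
  shift : ℕ → Series → Series
  shift zero    f n       = f n
  shift (suc d) f zero    = 0ℤ
  shift (suc d) f (suc n) = shift d f n

  δ-+ : ∀ k l n → shift k (δ l) n ≡ δ (k ℕ.+ l) n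
  δ-+ zero    l n       = refl
  δ-+ (suc k) l zero    = refl
  δ-+ (suc k) l (suc n) = δ-+ k l n

  δ-cancel : ∀ d k n → δ (d ℕ.+ k) (d ℕ.+ n) ≡ δ k n
  δ-cancel zero    k n = refl
  δ-cancel (suc d) k n = δ-cancel d k n

  infixl 7 _⊛_
  -- The Cauchy product, recursing on the tail of the left factor. No truncated subtraction occurs,
  -- and identities follow by induction on the exponent.
  _⊛_ : Series → Series → Series
  (f ⊛ g) zero    = f 0 * g 0
  (f ⊛ g) (suc n) = f 0 * g (suc n) + (f ∘ suc ⊛ g) n

  ⊛-cong-≤ : ∀ n {f f′ g g′ : Series} → (∀ i → i ≤ n → f i ≡ f′ i) →
    (∀ i → i ≤ n → g i ≡ g′ i) → (f ⊛ g) n ≡ (f′ ⊛ g′) n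
  ⊛-cong-≤ zero    f≡ g≡ = cong₂ _*_ (f≡ 0 z≤n) (g≡ 0 z≤n)
  ⊛-cong-≤ (suc n) f≡ g≡ = cong₂ _+_ (cong₂ _*_ (f≡ 0 z≤n) (g≡ (suc n) ℕₚ.≤-refl))
    (⊛-cong-≤ n (λ i i≤n → f≡ (suc i) (s≤s i≤n)) (λ i i≤n → g≡ i (ℕₚ.m≤n⇒m≤1+n i≤n)))

  ⊛-congˡ : ∀ f {g g′ : Series} → g ≗ g′ → f ⊛ g ≗ f ⊛ g′
  ⊛-congˡ f g≗ n = ⊛-cong-≤ n (λ _ _ → refl) (λ i _ → g≗ i)

  ⊛-congʳ : ∀ g {f f′ : Series} → f ≗ f′ → f ⊛ g ≗ f′ ⊛ g
  ⊛-congʳ g f≗ n = ⊛-cong-≤ n (λ i _ → f≗ i) (λ _ _ → refl)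

  ⊛-zeroˡ : ∀ g → (λ _ → 0ℤ) ⊛ g ≗ λ _ → 0ℤ
  ⊛-zeroˡ g zero    = refl
  ⊛-zeroˡ g (suc n) = trans (ℤₚ.+-identityˡ _) (⊛-zeroˡ g n)

  ⊛-zeroʳ : ∀ f → f ⊛ (λ _ → 0ℤ) ≗ λ _ → 0ℤ
  ⊛-zeroʳ f zero    = ℤₚ.*-zeroʳ (f 0)
  ⊛-zeroʳ f (suc n) = cong₂ _+_ (ℤₚ.*-zeroʳ (f 0)) (⊛-zeroʳ (f ∘ suc) n)

  ⊛-distribʳ : ∀ f f′ g n → ((λ i → f i + f′ i) ⊛ g) n ≡ (f ⊛ g) n + (f′ ⊛ g) n
  ⊛-distribʳ f f′ g zero    = ℤₚ.*-distribʳ-+ (g 0) (f 0) (f′ 0)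
  ⊛-distribʳ f f′ g (suc n) = trans
    (cong (_+_ ((f 0 + f′ 0) * g (suc n))) (⊛-distribʳ (f ∘ suc) (f′ ∘ suc) g n))
    (rearrange (f 0) (f′ 0) (g (suc n)) _ _)
    where
    rearrange : ∀ a b c d e → (a + b) * c + (d + e) ≡ (a * c + d) + (b * c + e)
    rearrange = solve-∀

  ⊛-distribˡ : ∀ f g g′ n → (f ⊛ (λ i → g i + g′ i)) n ≡ (f ⊛ g) n + (f ⊛ g′) n
  ⊛-distribˡ f g g′ zero    = ℤₚ.*-distribˡ-+ (f 0) (g 0) (g′ 0)
  ⊛-distribˡ f g g′ (suc n) = trans
    (cong (_+_ (f 0 * (g (suc n) + g′ (suc n)))) (⊛-distribˡ (f ∘ suc) g g′ n))
    (rearrange (f 0) (g (suc n)) (g′ (suc n)) _ _)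
    where
    rearrange : ∀ a b c d e → a * (b + c) + (d + e) ≡ (a * b + d) + (a * c + e)
    rearrange = solve-∀

  ⊛-scaleˡ : ∀ c f g n → ((λ i → c * f i) ⊛ g) n ≡ c * (f ⊛ g) n
  ⊛-scaleˡ c f g zero    = ℤₚ.*-assoc c (f 0) (g 0)
  ⊛-scaleˡ c f g (suc n) = trans
    (cong (_+_ (c * f 0 * g (suc n))) (⊛-scaleˡ c (f ∘ suc) g n))
    (rearrange c (f 0) (g (suc n)) _)
    where
    rearrange : ∀ a b c d → a * b * c + a * d ≡ a * (b * c + d)
    rearrange = solve-∀

  ⊛-scaleʳ : ∀ c f g n → (f ⊛ (λ i → c * g i)) n ≡ c * (f ⊛ g) n
  ⊛-scaleʳ c f g zero    = swap (f 0) c (g 0)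
    where
    swap : ∀ a b c → a * (b * c) ≡ b * (a * c)
    swap = solve-∀
  ⊛-scaleʳ c f g (suc n) = trans
    (cong (_+_ (f 0 * (c * g (suc n)))) (⊛-scaleʳ c (f ∘ suc) g n))
    (rearrange c (f 0) (g (suc n)) _)
    where
    rearrange : ∀ a b c d → b * (a * c) + a * d ≡ a * (b * c + d)
    rearrange = solve-∀

  ⊛-∑ˡ : ∀ m (F : ℕ → Series) g n →
    ((λ i → ∑[ a < m ] F a i) ⊛ g) n ≡ ∑[ a < m ] (F a ⊛ g) n
  ⊛-∑ˡ zero    F g n = ⊛-zeroˡ g n
  ⊛-∑ˡ (suc m) F g n = trans (⊛-distribʳ (F 0) _ g n)
    (cong (_+_ ((F 0 ⊛ g) n)) (⊛-∑ˡ m (F ∘ suc) g n))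

  ⊛-∑ʳ : ∀ m f (G : ℕ → Series) n →
    (f ⊛ (λ i → ∑[ a < m ] G a i)) n ≡ ∑[ a < m ] (f ⊛ G a) n
  ⊛-∑ʳ zero    f G n = ⊛-zeroʳ f n
  ⊛-∑ʳ (suc m) f G n = trans (⊛-distribˡ f (G 0) _ n)
    (cong (_+_ ((f ⊛ G 0) n)) (⊛-∑ʳ m f (G ∘ suc) n))

  ⊛-∑²ˡ : ∀ m (F : ℕ → ℕ → Series) g n →
    ((λ i → ∑²[ a , b < m ] F a b i) ⊛ g) n ≡ ∑²[ a , b < m ] (F a b ⊛ g) n
  ⊛-∑²ˡ m F g n = trans (⊛-∑ˡ m _ g n) (∑-cong m (λ a → ⊛-∑ˡ m (F a) g n))

  ⊛-∑²ʳ : ∀ m f (G : ℕ → ℕ → Series) n →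
    (f ⊛ (λ i → ∑²[ a , b < m ] G a b i)) n ≡ ∑²[ a , b < m ] (f ⊛ G a b) n
  ⊛-∑²ʳ m f G n = trans (⊛-∑ʳ m f _ n) (∑-cong m (λ a → ⊛-∑ʳ m f (G a) n))

  ⊛-assoc : ∀ f g h → (f ⊛ g) ⊛ h ≗ f ⊛ (g ⊛ h)
  ⊛-assoc f g h zero    = ℤₚ.*-assoc (f 0) (g 0) (h 0)
  ⊛-assoc f g h (suc n) = begin
    f 0 * g 0 * h (suc n) + ((λ i → f 0 * g (suc i) + (f ∘ suc ⊛ g) i) ⊛ h) n
      ≡⟨ cong (_+_ (f 0 * g 0 * h (suc n))) (⊛-distribʳ _ (f ∘ suc ⊛ g) h n) ⟩
    f 0 * g 0 * h (suc n) + (((λ i → f 0 * g (suc i)) ⊛ h) n + (f ∘ suc ⊛ g ⊛ h) n)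
      ≡⟨ cong (_+_ (f 0 * g 0 * h (suc n)))
           (cong₂ _+_ (⊛-scaleˡ (f 0) (g ∘ suc) h n) (⊛-assoc (f ∘ suc) g h n)) ⟩
    f 0 * g 0 * h (suc n) + (f 0 * (g ∘ suc ⊛ h) n + (f ∘ suc ⊛ (g ⊛ h)) n)
      ≡⟨ rearrange (f 0) (g 0) (h (suc n)) _ _ ⟩
    f 0 * (g 0 * h (suc n) + (g ∘ suc ⊛ h) n) + (f ∘ suc ⊛ (g ⊛ h)) n ∎
    where
    rearrange : ∀ a b c d e → a * b * c + (a * d + e) ≡ a * (b * c + d) + e
    rearrange = solve-∀

  shift-cong : ∀ d {f g : Series} → f ≗ g → shift d f ≗ shift d g
  shift-cong zero    f≗g n       = f≗g n
  shift-cong (suc d) f≗g zero    = refl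
  shift-cong (suc d) f≗g (suc n) = shift-cong d f≗g n

  shift-< : ∀ {d n} f → n < d → shift d f n ≡ 0ℤ
  shift-< {suc d} {zero}  f _         = refl
  shift-< {suc d} {suc n} f (s≤s n<d) = shift-< f n<d

  shift-≥ : ∀ d k f → shift d f (d ℕ.+ k) ≡ f k
  shift-≥ zero    k f = refl
  shift-≥ (suc d) k f = shift-≥ d k f

  shift-∸ : ∀ {d n} f → d ≤ n → shift d f n ≡ f (n ∸ d)
  shift-∸ {zero}          f _         = refl
  shift-∸ {suc d} {suc n} f (s≤s d≤n) = shift-∸ f d≤n

  shift-zero : ∀ d n → shift d (λ _ → 0ℤ) n ≡ 0ℤ
  shift-zero zero    n       = refl
  shift-zero (suc d) zero    = refl
  shift-zero (suc d) (suc n) = shift-zero d n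

  shift-distrib : ∀ d f g n → shift d (λ i → f i + g i) n ≡ shift d f n + shift d g n
  shift-distrib zero    f g n       = refl
  shift-distrib (suc d) f g zero    = refl
  shift-distrib (suc d) f g (suc n) = shift-distrib d f g n

  shift-scale : ∀ d c f n → shift d (λ i → c * f i) n ≡ c * shift d f n
  shift-scale zero    c f n       = refl
  shift-scale (suc d) c f zero    = sym (ℤₚ.*-zeroʳ c)
  shift-scale (suc d) c f (suc n) = shift-scale d c f n

  shift-shift : ∀ d e f n → shift d (shift e f) n ≡ shift (d ℕ.+ e) f n
  shift-shift zero    e f n       = refl
  shift-shift (suc d) e f zero    = refl
  shift-shift (suc d) e f (suc n) = shift-shift d e f n

  shift-comm : ∀ d e f n → shift d (shift e f) n ≡ shift e (shift d f) n
  shift-comm d e f n = begin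
    shift d (shift e f) n ≡⟨ shift-shift d e f n ⟩
    shift (d ℕ.+ e) f n   ≡⟨ cong (λ k → shift k f n) (ℕₚ.+-comm d e) ⟩
    shift (e ℕ.+ d) f n   ≡⟨ shift-shift e d f n ⟨
    shift e (shift d f) n ∎

  shift-⊛ˡ : ∀ d f g → shift d f ⊛ g ≗ shift d (f ⊛ g)
  shift-⊛ˡ zero    f g n       = refl
  shift-⊛ˡ (suc d) f g zero    = refl
  shift-⊛ˡ (suc d) f g (suc n) = trans (ℤₚ.+-identityˡ _) (shift-⊛ˡ d f g n)

  shift-suc : ∀ d f → shift (suc d) f ≗ shift 1 (shift d f)
  shift-suc d f zero    = refl
  shift-suc d f (suc n) = refl

  -- The recursion of `_⊛_` consumes the left factor, so a power of q on the right has to be carried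
  -- across one q at a time.
  shift-⊛ʳ : ∀ d f g → f ⊛ shift d g ≗ shift d (f ⊛ g)
  shift-⊛ʳ zero    f g n = refl
  shift-⊛ʳ (suc d) f g n = begin
    (f ⊛ shift (suc d) g) n    ≡⟨ ⊛-congˡ f (shift-suc d g) n ⟩
    (f ⊛ shift 1 (shift d g)) n ≡⟨ shift₁ f (shift d g) n ⟩
    shift 1 (f ⊛ shift d g) n   ≡⟨ shift-cong 1 (shift-⊛ʳ d f g) n ⟩
    shift 1 (shift d (f ⊛ g)) n ≡⟨ shift-suc d (f ⊛ g) n ⟨
    shift (suc d) (f ⊛ g) n     ∎
    where
    shift₁ : ∀ f g → f ⊛ shift 1 g ≗ shift 1 (f ⊛ g)
    shift₁ f g zero          = ℤₚ.*-zeroʳ (f 0)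
    shift₁ f g (suc zero)    = trans (cong (_+_ (f 0 * g 0)) (ℤₚ.*-zeroʳ (f 1))) (ℤₚ.+-identityʳ _)
    shift₁ f g (suc (suc n)) = cong (_+_ (f 0 * g (suc n))) (shift₁ (f ∘ suc) g (suc n))

  δ-⊛ : ∀ k g → δ k ⊛ g ≗ shift k g
  δ-⊛ zero    g zero    = ℤₚ.*-identityˡ (g 0)
  δ-⊛ zero    g (suc n) = trans
    (cong₂ _+_ (ℤₚ.*-identityˡ (g (suc n))) (⊛-zeroˡ g n)) (ℤₚ.+-identityʳ _)
  δ-⊛ (suc k) g zero    = refl
  δ-⊛ (suc k) g (suc n) = trans (ℤₚ.+-identityˡ _) (δ-⊛ k g n)

  -- q d/dq
  θ : Series → Series
  θ f n = + n * f n

  θ-⊛ : ∀ f g n → θ (f ⊛ g) n ≡ (θ f ⊛ g) n + (f ⊛ θ g) n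
  θ-⊛ f g zero    = sym (trans (ℤₚ.+-identityˡ _) (ℤₚ.*-zeroʳ (f 0)))
  θ-⊛ f g (suc n) = begin
    + suc n * (f 0 * g (suc n) + fg)
      ≡⟨ expand (+ n) (f 0) (g (suc n)) fg ⟩
    + suc n * (f 0 * g (suc n)) + (fg + θ (f ∘ suc ⊛ g) n)
      ≡⟨ cong (λ s → + suc n * (f 0 * g (suc n)) + (fg + s)) (θ-⊛ (f ∘ suc) g n) ⟩
    + suc n * (f 0 * g (suc n)) + (fg + ((θ (f ∘ suc) ⊛ g) n + (f ∘ suc ⊛ θ g) n))
      ≡⟨ rearrange (+ suc n) (f 0) (g (suc n)) fg ((θ (f ∘ suc) ⊛ g) n) _ ⟩
    (fg + (θ (f ∘ suc) ⊛ g) n) + (f ⊛ θ g) (suc n)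
      ≡⟨ cong (_+ (f ⊛ θ g) (suc n)) (⊛-distribʳ (f ∘ suc) (θ (f ∘ suc)) g n) ⟨
    ((λ i → f (suc i) + θ (f ∘ suc) i) ⊛ g) n + (f ⊛ θ g) (suc n)
      -- Dropping the constant term lowers exponents by one, so `θ f (suc i)` exceeds
      -- `θ (f ∘ suc) i` by `f (suc i)`; this accounts for the extra `fg`.
      ≡⟨ cong (_+ (f ⊛ θ g) (suc n)) (⊛-congʳ g (λ i → ℤₚ.suc-* (+ i) (f (suc i))) n) ⟨
    (θ f ∘ suc ⊛ g) n + (f ⊛ θ g) (suc n)
      ≡⟨ cong (_+ (f ⊛ θ g) (suc n)) (ℤₚ.+-identityˡ ((θ f ∘ suc ⊛ g) n)) ⟨
    (θ f ⊛ g) (suc n) + (f ⊛ θ g) (suc n) ∎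
    where
    fg : ℤ
    fg = (f ∘ suc ⊛ g) n
    expand : ∀ n a b c → (+ 1 + n) * (a * b + c) ≡ (+ 1 + n) * (a * b) + (c + n * c)
    expand = solve-∀
    rearrange : ∀ a b c x y z →
      a * (b * c) + (x + (y + z)) ≡ (x + y) + (b * (a * c) + z)
    rearrange = solve-∀

  θ-shift : ∀ d f n → θ (shift d f) n ≡ + d * shift d f n + shift d (θ f) n
  θ-shift zero    f n       = sym (ℤₚ.+-identityˡ _)
  θ-shift (suc d) f zero    = sym (trans (ℤₚ.+-identityʳ _) (ℤₚ.*-zeroʳ (+ suc d)))
  θ-shift (suc d) f (suc n) = begin
    + suc n * s                    ≡⟨ ℤₚ.suc-* (+ n) s ⟩
    s + + n * s                    ≡⟨ cong (_+_ s) (θ-shift d f n) ⟩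
    s + (+ d * s + shift d (θ f) n) ≡⟨ regroup s (+ d) (shift d (θ f) n) ⟩
    + suc d * s + shift d (θ f) n  ∎
    where
    s : ℤ
    s = shift d f n
    regroup : ∀ s d t → s + (d * s + t) ≡ (+ 1 + d) * s + t
    regroup = solve-∀

  -- A series F is determined by F − qᵈ F when d ≥ 1.
  shift-unique : ∀ d (F G R : Series) → (∀ n → F n ≡ R n + shift (suc d) F n) →
    (∀ n → G n ≡ R n + shift (suc d) G n) → F ≗ G
  shift-unique d F G R F≡ G≡ n = below (suc n) n ℕₚ.≤-refl
    where
    shift-below : ∀ b e → (∀ i → i < b → F i ≡ G i) → ∀ i → i < b → shift e F i ≡ shift e G i
    shift-below b zero    eq i       i<b = eq i i<b
    shift-below b (suc e) eq zero    i<b = refl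
    shift-below b (suc e) eq (suc i) i<b = shift-below b e eq i (ℕₚ.<-trans ℕₚ.≤-refl i<b)
    below : ∀ b i → i < b → F i ≡ G i
    below (suc b) zero    _         = trans (F≡ 0) (sym (G≡ 0))
    below (suc b) (suc i) (s≤s i<b) = trans (F≡ (suc i))
      (trans (cong (_+_ (R (suc i))) (shift-below b d (below b) i i<b)) (sym (G≡ (suc i))))

  -- Divisor sums

  -- The condition that a is a divisor is encoded by a sum over cofactors x with a x = n, so that
  -- only finite sums are ever manipulated. The bound `n` suffices since both factors are positive.
  divisorSum : (ℕ → ℤ) → Series
  divisorSum φ n = ∑²[ a , x < n ] δ (suc a ℕ.* suc x) n * φ (suc a)

  σ₁ σ₃ : Series
  σ₁ = divisorSum (λ d → + d)
  σ₃ = divisorSum (λ d → + d * + d * + d)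

  δ-≥ : ∀ {k n i} → n ≤ i → i < k → ∀ c → δ k n * c ≡ 0ℤ
  δ-≥ n≤i i<k c = trans (cong (_* c) (δ-> (ℕₚ.≤-<-trans n≤i i<k))) (ℤₚ.*-zeroˡ c)

  divisorSum-extend : ∀ φ {m n} → n ≤ m →
    ∑²[ a , x < m ] δ (suc a ℕ.* suc x) n * φ (suc a) ≡ divisorSum φ n
  divisorSum-extend φ {m} {n} n≤m = trans
    (∑-extend n≤m (λ a n≤a → ∑-zero m (λ x → δ-≥ n≤a (ℕₚ.m≤m*n (suc a) (suc x)) _)))
    (∑-cong n (λ a → ∑-extend n≤m (λ x n≤x → δ-≥ n≤x (ℕₚ.m≤n*m (suc x) (suc a)) _)))

  -- The sum of g a b over all a, b, x, y ≥ 1 with a x + b y = n, all of which are ≤ n.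
  quadSum : (ℕ → ℕ → ℤ) → Series
  quadSum g n =
    ∑²[ a , b < n ] ∑²[ x , y < n ] δ (suc a ℕ.* suc x ℕ.+ suc b ℕ.* suc y) n * g (suc a) (suc b)

  σ₁⊛σ₁ : ∀ n → (σ₁ ⊛ σ₁) n ≡ quadSum (λ a b → + a * + b) n
  σ₁⊛σ₁ n = begin
    (σ₁ ⊛ σ₁) n
      -- All coefficients up to `n` are given the common bound `n`; only then can the sums be pulled
      -- out of the product.
      ≡⟨ ⊛-cong-≤ n extend extend ⟨
    (T ⊛ T) n
      ≡⟨ ⊛-∑²ˡ n _ T n ⟩
    ∑²[ a , x < n ] ((λ i → t a x i) ⊛ T) n
      ≡⟨ ∑²-cong n (λ a x → ⊛-∑²ʳ n (t a x) _ n) ⟩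
    ∑²[ a , x < n ] ∑²[ b , y < n ] (t a x ⊛ t b y) n
      ≡⟨ ∑²-cong n (λ a x → ∑²-cong n (λ b y → t⊛t a x b y)) ⟩
    ∑²[ a , x < n ] ∑²[ b , y < n ] u a b x y
      ≡⟨ ∑-cong n (λ a → ∑-swap n n _) ⟩
    ∑²[ a , b < n ] ∑²[ x , y < n ] u a b x y ∎
    where
    t : ℕ → ℕ → Series
    t a x i = δ (suc a ℕ.* suc x) i * + suc a
    T : Series
    T i = ∑²[ a , x < n ] t a x i
    extend : ∀ i → i ≤ n → T i ≡ σ₁ i
    extend i = divisorSum-extend (λ d → + d)
    u : ℕ → ℕ → ℕ → ℕ → ℤ
    u a b x y = δ (suc a ℕ.* suc x ℕ.+ suc b ℕ.* suc y) n * (+ suc a * + suc b)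
    t⊛t : ∀ a x b y → (t a x ⊛ t b y) n ≡ u a b x y
    t⊛t a x b y = begin
      (t a x ⊛ t b y) n
        ≡⟨ ⊛-congʳ (t b y) (λ i → ℤₚ.*-comm (δ k i) A) n ⟩
      ((λ i → A * δ k i) ⊛ t b y) n
        ≡⟨ ⊛-congˡ _ (λ i → ℤₚ.*-comm (δ l i) B) n ⟩
      ((λ i → A * δ k i) ⊛ (λ i → B * δ l i)) n
        ≡⟨ trans (⊛-scaleˡ A (δ k) _ n) (cong (_*_ A) (⊛-scaleʳ B (δ k) (δ l) n)) ⟩
      A * (B * (δ k ⊛ δ l) n)
        ≡⟨ cong (λ s → A * (B * s)) (trans (δ-⊛ k (δ l) n) (δ-+ k l n)) ⟩
      A * (B * δ (k ℕ.+ l) n)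
        ≡⟨ rotate A B (δ (k ℕ.+ l) n) ⟩
      δ (k ℕ.+ l) n * (A * B) ∎
      where
      k l : ℕ
      k = suc a ℕ.* suc x
      l = suc b ℕ.* suc y
      A B : ℤ
      A = + suc a
      B = + suc b
      rotate : ∀ a b c → a * (b * c) ≡ c * (a * b)
      rotate = solve-∀

  -- The convolution identity for σ₁

  module _ (n : ℕ) where

    private
      -- Since (b + c) x + b y = b (x + y) + c x, one kernel describes both the solutions with
      -- unequal coefficients b + c > b and those with unequal cofactors x + y > x. This bijection
      -- links the two trichotomies.
      K : ℕ → ℕ → ℕ → ℕ → ℤ
      K b c x y = δ ((suc b ℕ.+ suc c) ℕ.* suc x ℕ.+ suc b ℕ.* suc y) n

      +-suc-suc : ∀ a b → suc (suc (a ℕ.+ b)) ≡ suc a ℕ.+ suc b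
      +-suc-suc = ℕ-Solver.solve-∀

      double : ∀ s → s + s ≡ + 2 * s
      double = solve-∀

    -- A larger first coefficient is written as b + c. The opposite case is the mirror image under
    -- exchanging both coefficients and cofactors, and symmetry of `g` turns the pair into the
    -- factor 2.
    quadSum-trichotomy-ab : ∀ g → (∀ a b → g a b ≡ g b a) → quadSum g n ≡
      ∑[ a < n ] ∑²[ x , y < n ] δ (suc a ℕ.* suc x ℕ.+ suc a ℕ.* suc y) n * g (suc a) (suc a) +
      + 2 * (∑²[ b , c < n ] ∑²[ x , y < n ] K b c x y * g (suc b ℕ.+ suc c) (suc b))
    quadSum-trichotomy-ab g g-sym = begin
      quadSum g n
        ≡⟨ ∑²-trichotomy n (λ a b → ∑² n (L a b))
             (λ a b n≤a → ∑²-zero n (λ x y → δ-≥ n≤a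
               (ℕₚ.≤-trans (ℕₚ.m≤m*n (suc a) (suc x)) (ℕₚ.m≤m+n (suc a ℕ.* suc x) _)) (g (suc a) (suc b))))
             (λ a b n≤b → ∑²-zero n (λ x y → δ-≥ n≤b
               (ℕₚ.≤-trans (ℕₚ.m≤m*n (suc b) (suc y)) (ℕₚ.m≤n+m (suc b ℕ.* suc y) (suc a ℕ.* suc x))) (g (suc a) (suc b)))) ⟩
      diag + (∑²[ b , c < n ] ∑² n (L (suc (b ℕ.+ c)) b) + ∑²[ b , c < n ] ∑² n (L b (suc (b ℕ.+ c))))
        ≡⟨ cong (_+_ diag) (cong₂ _+_
             (∑²-cong n (λ b c → ∑²-cong n (off₁ b c)))
             (∑²-cong n (λ b c → trans (∑²-transpose n _) (∑²-cong n (off₂ b c))))) ⟩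
      diag + (off + off)
        ≡⟨ cong (_+_ diag) (double off) ⟩
      diag + + 2 * off ∎
      where
      L : ℕ → ℕ → ℕ → ℕ → ℤ
      L a b x y = δ (suc a ℕ.* suc x ℕ.+ suc b ℕ.* suc y) n * g (suc a) (suc b)
      diag off : ℤ
      diag = ∑[ a < n ] ∑² n (L a a)
      off  = ∑²[ b , c < n ] ∑²[ x , y < n ] K b c x y * g (suc b ℕ.+ suc c) (suc b)
      off₁ : ∀ b c x y → L (suc (b ℕ.+ c)) b x y ≡ K b c x y * g (suc b ℕ.+ suc c) (suc b)
      off₁ b c x y = cong (λ a → δ (a ℕ.* suc x ℕ.+ suc b ℕ.* suc y) n * g a (suc b)) (+-suc-suc b c)
      off₂ : ∀ b c x y → L b (suc (b ℕ.+ c)) y x ≡ K b c x y * g (suc b ℕ.+ suc c) (suc b)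
      off₂ b c x y = trans
        (cong₂ (λ k z → δ k n * z) (ℕₚ.+-comm (suc b ℕ.* suc y) _) (g-sym (suc b) _))
        (off₁ b c x y)

    -- Now the cofactors are compared. The kernel is the same, but the weight is evaluated at b and
    -- c instead of b + c and b.
    quadSum-trichotomy-xy : ∀ g → (∀ a b → g a b ≡ g b a) → quadSum g n ≡
      ∑[ x < n ] ∑²[ a , b < n ] δ (suc a ℕ.* suc x ℕ.+ suc b ℕ.* suc x) n * g (suc a) (suc b) +
      + 2 * (∑²[ b , c < n ] ∑²[ x , y < n ] K b c x y * g (suc b) (suc c))
    quadSum-trichotomy-xy g g-sym = begin
      quadSum g n
        ≡⟨ ∑²-swap n (λ a b x y → L x y a b) ⟩
      ∑²[ x , y < n ] ∑² n (L x y)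
        ≡⟨ ∑²-trichotomy n (λ x y → ∑² n (L x y))
             (λ x y n≤x → ∑²-zero n (λ a b → δ-≥ n≤x
               (ℕₚ.≤-trans (ℕₚ.m≤n*m (suc x) (suc a)) (ℕₚ.m≤m+n (suc a ℕ.* suc x) _)) (g (suc a) (suc b))))
             (λ x y n≤y → ∑²-zero n (λ a b → δ-≥ n≤y
               (ℕₚ.≤-trans (ℕₚ.m≤n*m (suc y) (suc b)) (ℕₚ.m≤n+m (suc b ℕ.* suc y) (suc a ℕ.* suc x))) (g (suc a) (suc b)))) ⟩
      diag + (∑²[ x , y < n ] ∑² n (L (suc (x ℕ.+ y)) x) + ∑²[ x , y < n ] ∑² n (L x (suc (x ℕ.+ y))))
        ≡⟨ cong (_+_ diag) (cong₂ _+_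
             (∑²-cong n (λ x y → ∑²-cong n (λ a b →
               cong (λ k → δ k n * g (suc a) (suc b)) (weight₁ a b x y))))
             (∑²-cong n (λ x y → trans (∑²-transpose n _) (∑²-cong n (λ a b →
               cong₂ (λ k z → δ k n * z) (weight₂ a b x y) (g-sym (suc b) (suc a))))))) ⟩
      diag + (off + off)
        ≡⟨ cong (_+_ diag) (double off) ⟩
      diag + + 2 * off
        ≡⟨ cong (λ s → diag + + 2 * s)
             (∑²-swap n (λ x y b c → K b c x y * g (suc b) (suc c))) ⟩
      diag + + 2 * (∑²[ b , c < n ] ∑²[ x , y < n ] K b c x y * g (suc b) (suc c)) ∎
      where
      L : ℕ → ℕ → ℕ → ℕ → ℤ
      L x y a b = δ (suc a ℕ.* suc x ℕ.+ suc b ℕ.* suc y) n * g (suc a) (suc b)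
      diag off : ℤ
      diag = ∑[ x < n ] ∑² n (L x x)
      off  = ∑²[ x , y < n ] ∑²[ b , c < n ] K b c x y * g (suc b) (suc c)
      weight₁ : ∀ a b x y → suc a ℕ.* suc (suc (x ℕ.+ y)) ℕ.+ suc b ℕ.* suc x ≡
                            (suc a ℕ.+ suc b) ℕ.* suc x ℕ.+ suc a ℕ.* suc y
      weight₁ = ℕ-Solver.solve-∀
      weight₂ : ∀ a b x y → suc b ℕ.* suc x ℕ.+ suc a ℕ.* suc (suc (x ℕ.+ y)) ≡
                            (suc a ℕ.+ suc b) ℕ.* suc x ℕ.+ suc a ℕ.* suc y
      weight₂ = ℕ-Solver.solve-∀

    diagonal-xy diagonal-ab : ℤ
    diagonal-xy = ∑[ x < n ] ∑²[ a , b < n ] δ (suc a ℕ.* suc x ℕ.+ suc b ℕ.* suc x) n *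
      (+ suc a * + suc a + + suc a * + suc b + + suc b * + suc b)
    diagonal-ab = ∑[ a < n ] ∑²[ x , y < n ] δ (suc a ℕ.* suc x ℕ.+ suc a ℕ.* suc y) n *
      (+ suc a * + suc a)

    -- The forms a² ± ab + b² are chosen so that g⁻ (b + c) b = g⁺ b c: then the
    -- off-diagonal parts of the two trichotomies coincide.
    quadSum-diagonals :
      + 2 * quadSum (λ a b → + a * + b) n + diagonal-ab ≡ diagonal-xy
    quadSum-diagonals = cancel (begin
      + 2 * quadSum (λ a b → + a * + b) n + diagonal-ab + + 2 * off
        ≡⟨ cong (λ s → + 2 * quadSum (λ a b → + a * + b) n + s + + 2 * off)
             (∑-cong n (λ a → ∑²-cong n (λ x y → cong (_*_ (L a a x y)) (g⁻-diag (+ suc a))))) ⟨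
      + 2 * quadSum (λ a b → + a * + b) n + diag⁻ + + 2 * off
        ≡⟨ ℤₚ.+-assoc (+ 2 * quadSum (λ a b → + a * + b) n) diag⁻ (+ 2 * off) ⟩
      + 2 * quadSum (λ a b → + a * + b) n + (diag⁻ + + 2 * off)
        ≡⟨ cong (λ s → + 2 * quadSum (λ a b → + a * + b) n + (diag⁻ + + 2 * s))
             (∑²-cong n (λ b c → ∑²-cong n (λ x y → cong (_*_ (K b c x y)) (g⁻-shift (+ suc b) (+ suc c))))) ⟨
      + 2 * quadSum (λ a b → + a * + b) n + (diag⁻ + + 2 * off⁻)
        ≡⟨ cong (_+_ (+ 2 * quadSum (λ a b → + a * + b) n))
             (quadSum-trichotomy-ab g⁻ (λ a b → g⁻-sym (+ a) (+ b))) ⟨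
      + 2 * quadSum (λ a b → + a * + b) n + quadSum g⁻ n
        ≡⟨ cong (_+ quadSum g⁻ n) (∑⁴-*ˡ (+ 2) _) ⟨
      ∑²[ a , b < n ] ∑²[ x , y < n ] + 2 * (L a b x y * (+ suc a * + suc b)) + quadSum g⁻ n
        ≡⟨ ∑⁴-+ _ _ ⟨
      ∑²[ a , b < n ] ∑²[ x , y < n ]
        (+ 2 * (L a b x y * (+ suc a * + suc b)) + L a b x y * g⁻ (suc a) (suc b))
        -- The weight of the convolution enters as half the difference of the two forms: `g⁺` minus
        -- `g⁻` is 2ab.
        ≡⟨ ∑²-cong n (λ a b → ∑²-cong n (λ x y → g⁺-split (L a b x y) (+ suc a) (+ suc b))) ⟩
      quadSum g⁺ n
        ≡⟨ quadSum-trichotomy-xy g⁺ (λ a b → g⁺-sym (+ a) (+ b)) ⟩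
      diagonal-xy + + 2 * off ∎)
      where
      g⁺ g⁻ : ℕ → ℕ → ℤ
      g⁺ a b = + a * + a + + a * + b + + b * + b
      g⁻ a b = + a * + a - + a * + b + + b * + b
      L : ℕ → ℕ → ℕ → ℕ → ℤ
      L a b x y = δ (suc a ℕ.* suc x ℕ.+ suc b ℕ.* suc y) n
      off off⁻ diag⁻ : ℤ
      off = ∑²[ b , c < n ] ∑²[ x , y < n ] K b c x y * g⁺ (suc b) (suc c)
      off⁻ = ∑²[ b , c < n ] ∑²[ x , y < n ] K b c x y * g⁻ (suc b ℕ.+ suc c) (suc b)
      diag⁻ = ∑[ a < n ] ∑²[ x , y < n ]
        δ (suc a ℕ.* suc x ℕ.+ suc a ℕ.* suc y) n * g⁻ (suc a) (suc a)
      g⁺-sym : ∀ a b → a * a + a * b + b * b ≡ b * b + b * a + a * a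
      g⁺-sym = solve-∀
      g⁻-sym : ∀ a b → a * a - a * b + b * b ≡ b * b - b * a + a * a
      g⁻-sym = solve-∀
      g⁻-diag : ∀ a → a * a - a * a + a * a ≡ a * a
      g⁻-diag = solve-∀
      g⁻-shift : ∀ b c → (b + c) * (b + c) - (b + c) * b + b * b ≡ b * b + b * c + c * c
      g⁻-shift = solve-∀
      g⁺-split : ∀ l a b → + 2 * (l * (a * b)) + l * (a * a - a * b + b * b) ≡
                           l * (a * a + a * b + b * b)
      g⁺-split = solve-∀
      ∑⁴-+ : ∀ (f h : ℕ → ℕ → ℕ → ℕ → ℤ) →
        ∑²[ a , b < n ] ∑²[ x , y < n ] (f a b x y + h a b x y) ≡
        ∑²[ a , b < n ] ∑² n (f a b) + ∑²[ a , b < n ] ∑² n (h a b)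
      ∑⁴-+ f h = trans (∑²-cong n (λ a b → ∑²-+ n (f a b) (h a b))) (∑²-+ n _ _)
      ∑⁴-*ˡ : ∀ c (f : ℕ → ℕ → ℕ → ℕ → ℤ) →
        ∑²[ a , b < n ] ∑²[ x , y < n ] c * f a b x y ≡ c * (∑²[ a , b < n ] ∑² n (f a b))
      ∑⁴-*ˡ c f = trans (∑²-cong n (λ a b → ∑²-*ˡ n c (f a b))) (∑²-*ˡ n c _)
      cancel : ∀ {x y} → x + + 2 * off ≡ y + + 2 * off → x ≡ y
      cancel {x} {y} = ∙-cancelʳ (+ 2 * off) x y

    -- Evaluation of the two diagonals

    ∑²-by-total : (f : ℕ → ℕ → ℤ) → (∀ i j → n ≤ j → f i j ≡ 0ℤ) →
      ∑²[ i , k < n ] f i (suc (i ℕ.+ k)) ≡ ∑[ j < n ] ∑[ i < j ] f i j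
    ∑²-by-total f f≡0 = trans (∑-∸-extend n f f≡0) (∑-triangle n f)

    -- On this diagonal a (x + y) = n. A total D = x + y splits into two positive terms in D - 1
    -- ways, and D is `suc d`, whence the factor `+ d`.
    diagonal-ab≡ : diagonal-ab ≡
      ∑²[ a , d < n ] δ (suc a ℕ.* suc d) n * (+ d * (+ suc a * + suc a))
    diagonal-ab≡ = ∑-cong n λ a → begin
      ∑²[ x , y < n ] δ (suc a ℕ.* suc x ℕ.+ suc a ℕ.* suc y) n * (+ suc a * + suc a)
        ≡⟨ ∑²-cong n (λ x y → cong (λ k → δ k n * (+ suc a * + suc a)) (total a x y)) ⟩
      ∑²[ x , y < n ] δ (suc a ℕ.* suc (suc (x ℕ.+ y))) n * (+ suc a * + suc a)
        ≡⟨ ∑²-by-total (λ x d → δ (suc a ℕ.* suc d) n * (+ suc a * + suc a))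
             (λ x d n≤d → δ-≥ n≤d (ℕₚ.m≤n*m (suc d) (suc a)) _) ⟩
      ∑[ d < n ] ∑[ x < d ] δ (suc a ℕ.* suc d) n * (+ suc a * + suc a)
        ≡⟨ ∑-cong n (λ d → trans (∑-const d _) (rotate (+ d) (δ (suc a ℕ.* suc d) n) (+ suc a * + suc a))) ⟩
      ∑[ d < n ] δ (suc a ℕ.* suc d) n * (+ d * (+ suc a * + suc a)) ∎
      where
      total : ∀ a x y → suc a ℕ.* suc x ℕ.+ suc a ℕ.* suc y ≡ suc a ℕ.* suc (suc (x ℕ.+ y))
      total = ℕ-Solver.solve-∀
      rotate : ∀ a b c → a * (b * c) ≡ b * (a * c)
      rotate = solve-∀

    -- On this diagonal (a + b) x = n. With D = a + b the form a² + ab + b² becomes a² - aD + D²,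
    -- and a runs from 1 to D - 1.
    diagonal-xy≡ : diagonal-xy ≡ ∑²[ d , x < n ] δ (suc d ℕ.* suc x) n *
      (∑[ a < d ] (+ suc a * + suc a - + suc a * + suc d + + suc d * + suc d))
    diagonal-xy≡ = trans (∑-cong n λ x → begin
      ∑²[ a , b < n ] δ (suc a ℕ.* suc x ℕ.+ suc b ℕ.* suc x) n *
        (+ suc a * + suc a + + suc a * + suc b + + suc b * + suc b)
        ≡⟨ ∑²-cong n (λ a b → cong₂ _*_ (cong (λ k → δ k n) (total a b x)) (form a b)) ⟩
      ∑²[ a , b < n ] f x a (suc (a ℕ.+ b))
        ≡⟨ ∑²-by-total (f x) (λ a d n≤d → δ-≥ n≤d (ℕₚ.m≤m*n (suc d) (suc x)) _) ⟩
      ∑[ d < n ] ∑[ a < d ] f x a d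
        ≡⟨ ∑-cong n (λ d → ∑-*ˡ d (δ (suc d ℕ.* suc x) n) _) ⟩
      ∑[ d < n ] δ (suc d ℕ.* suc x) n *
        (∑[ a < d ] (+ suc a * + suc a - + suc a * + suc d + + suc d * + suc d)) ∎)
      (∑-swap n n _)
      where
      f : ℕ → ℕ → ℕ → ℤ
      f x a d = δ (suc d ℕ.* suc x) n *
        (+ suc a * + suc a - + suc a * + suc d + + suc d * + suc d)
      total : ∀ a b x → suc a ℕ.* suc x ℕ.+ suc b ℕ.* suc x ≡ suc (suc (a ℕ.+ b)) ℕ.* suc x
      total = ℕ-Solver.solve-∀
      form-ℤ : ∀ a b → a * a + a * b + b * b ≡ a * a - a * (a + b) + (a + b) * (a + b)
      form-ℤ = solve-∀
      form : ∀ a b → + suc a * + suc a + + suc a * + suc b + + suc b * + suc b ≡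
        + suc a * + suc a - + suc a * + suc (suc (a ℕ.+ b)) +
        + suc (suc (a ℕ.+ b)) * + suc (suc (a ℕ.+ b))
      form a b = trans (form-ℤ (+ suc a) (+ suc b))
        (cong (λ c → + suc a * + suc a - + suc a * + c + + c * + c) (sym (+-suc-suc a b)))

    -- Power sums up to D - 1 give 6 Σ (a² - aD + D²) = D (D - 1) (5D - 1). Its leading term is the
    -- origin of 5 σ₃.
    6*diagonal-xy : + 6 * diagonal-xy ≡ ∑²[ d , x < n ] δ (suc d ℕ.* suc x) n *
      (+ 5 * (+ suc d * + suc d * + suc d) - + 6 * (+ suc d * + suc d) + + suc d)
    6*diagonal-xy = begin
      + 6 * diagonal-xy
        ≡⟨ cong (_*_ (+ 6)) diagonal-xy≡ ⟩
      + 6 * (∑²[ d , x < n ] δ (suc d ℕ.* suc x) n * form d)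
        ≡⟨ ∑²-*ˡ n (+ 6) _ ⟨
      ∑²[ d , x < n ] + 6 * (δ (suc d ℕ.* suc x) n * form d)
        ≡⟨ ∑²-cong n (λ d x → trans (rotate (+ 6) (δ (suc d ℕ.* suc x) n) (form d))
             (cong (_*_ (δ (suc d ℕ.* suc x) n))
               (trans (partial (+ suc d) d) (total (+ d))))) ⟩
      ∑²[ d , x < n ] δ (suc d ℕ.* suc x) n *
        (+ 5 * (+ suc d * + suc d * + suc d) - + 6 * (+ suc d * + suc d) + + suc d) ∎
      where
      form : ℕ → ℤ
      form d = ∑[ a < d ] (+ suc a * + suc a - + suc a * + suc d + + suc d * + suc d)
      rotate : ∀ a b c → a * (b * c) ≡ b * (a * c)
      rotate = solve-∀
      -- `D` is kept apart from the upper limit `m`, so that the induction leaves the summand fixed;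
      -- D = m + 1 is imposed only in `total`.
      partial : ∀ D m → + 6 * (∑[ a < m ] (+ suc a * + suc a - + suc a * D + D * D)) ≡
        + m * ((+ m + + 1) * (+ 2 * + m + + 1) - + 3 * (+ m + + 1) * D + + 6 * D * D)
      partial D zero    = refl
      partial D (suc m) = begin
        + 6 * ∑ (suc m) q
          ≡⟨ cong (_*_ (+ 6)) (∑-snoc m q) ⟩
        + 6 * (∑ m q + q m)
          ≡⟨ ℤₚ.*-distribˡ-+ (+ 6) (∑ m q) (q m) ⟩
        + 6 * ∑ m q + + 6 * q m
          ≡⟨ cong (_+ + 6 * q m) (partial D m) ⟩
        + m * ((+ m + + 1) * (+ 2 * + m + + 1) - + 3 * (+ m + + 1) * D + + 6 * D * D) + + 6 * q m
          ≡⟨ step D (+ m) ⟩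
        + suc m * ((+ suc m + + 1) * (+ 2 * + suc m + + 1) - + 3 * (+ suc m + + 1) * D + + 6 * D * D) ∎
        where
        q : ℕ → ℤ
        q a = + suc a * + suc a - + suc a * D + D * D
        step : ∀ D m →
          m * ((m + + 1) * (+ 2 * m + + 1) - + 3 * (m + + 1) * D + + 6 * D * D) +
            + 6 * ((+ 1 + m) * (+ 1 + m) - (+ 1 + m) * D + D * D) ≡
          (+ 1 + m) * ((+ 1 + m + + 1) * (+ 2 * (+ 1 + m) + + 1) - + 3 * (+ 1 + m + + 1) * D + + 6 * D * D)
        step = solve-∀
      total : ∀ d → d * ((d + + 1) * (+ 2 * d + + 1) - + 3 * (d + + 1) * (+ 1 + d) + + 6 * (+ 1 + d) * (+ 1 + d)) ≡
        + 5 * ((+ 1 + d) * (+ 1 + d) * (+ 1 + d)) - + 6 * ((+ 1 + d) * (+ 1 + d)) + (+ 1 + d)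
      total = solve-∀

    -- With X the cofactor of D, D² = D · (D X) - (X - 1) D². On the support of `δ` the product D X
    -- is n, which yields θσ₁, and (X - 1) D² is the summand of `diagonal-ab`, so the squares
    -- cancel.
    σ₁⊛σ₁-formula : + 12 * (σ₁ ⊛ σ₁) n ≡ + 5 * σ₃ n + σ₁ n - + 6 * θ σ₁ n
    σ₁⊛σ₁-formula = ∙-cancelʳ (+ 6 * diagonal-ab) _ _ (begin
      + 12 * (σ₁ ⊛ σ₁) n + + 6 * diagonal-ab
        ≡⟨ cong (λ s → + 12 * s + + 6 * diagonal-ab) (σ₁⊛σ₁ n) ⟩
      + 12 * quadSum (λ a b → + a * + b) n + + 6 * diagonal-ab
        ≡⟨ factor (quadSum (λ a b → + a * + b) n) diagonal-ab ⟩
      + 6 * (+ 2 * quadSum (λ a b → + a * + b) n + diagonal-ab)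
        ≡⟨ cong (_*_ (+ 6)) quadSum-diagonals ⟩
      + 6 * diagonal-xy
        ≡⟨ 6*diagonal-xy ⟩
      ∑²[ d , x < n ] δ (suc d ℕ.* suc x) n *
        (+ 5 * (+ suc d * + suc d * + suc d) - + 6 * (+ suc d * + suc d) + + suc d)
        ≡⟨ ∑²-cong n (λ d x → trans
             (split (δ (suc d ℕ.* suc x) n) (+ suc d) (+ x))
             (cong (λ s → + 5 * (δ (suc d ℕ.* suc x) n * (+ suc d * + suc d * + suc d)) +
                          δ (suc d ℕ.* suc x) n * + suc d +
                          - + 6 * (+ suc d * s) +
                          + 6 * (δ (suc d ℕ.* suc x) n * (+ x * (+ suc d * + suc d))))
               (trans (cong (_*_ (δ (suc d ℕ.* suc x) n)) (sym (ℤₚ.pos-* (suc d) (suc x))))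
                 (δ-diag (suc d ℕ.* suc x) n (λ k → + k))))) ⟩
      ∑²[ d , x < n ] (+ 5 * (δ (suc d ℕ.* suc x) n * (+ suc d * + suc d * + suc d)) +
                       δ (suc d ℕ.* suc x) n * + suc d +
                       - + 6 * (+ suc d * (δ (suc d ℕ.* suc x) n * + n)) +
                       + 6 * (δ (suc d ℕ.* suc x) n * (+ x * (+ suc d * + suc d))))
        ≡⟨ ∑²-cong n (λ d x → collect (δ (suc d ℕ.* suc x) n) (+ suc d) (+ n)
             (+ 5 * (δ (suc d ℕ.* suc x) n * (+ suc d * + suc d * + suc d)))
             (+ 6 * (δ (suc d ℕ.* suc x) n * (+ x * (+ suc d * + suc d))))) ⟩
      ∑²[ d , x < n ] ((+ 5 * (δ (suc d ℕ.* suc x) n * (+ suc d * + suc d * + suc d)) +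
                       (1ℤ - + 6 * + n) * (δ (suc d ℕ.* suc x) n * + suc d)) +
                       + 6 * (δ (suc d ℕ.* suc x) n * (+ x * (+ suc d * + suc d))))
        ≡⟨ trans (∑²-+ n _ _) (cong₂ _+_
             (trans (∑²-+ n _ _) (cong₂ _+_ (∑²-*ˡ n (+ 5) _) (∑²-*ˡ n (1ℤ - + 6 * + n) _)))
             (∑²-*ˡ n (+ 6) _)) ⟩
      + 5 * σ₃ n + (1ℤ - + 6 * + n) * σ₁ n +
        + 6 * (∑²[ d , x < n ] δ (suc d ℕ.* suc x) n * (+ x * (+ suc d * + suc d)))
        ≡⟨ cong₂ (λ s t → s + + 6 * t) (expand (σ₃ n) (σ₁ n) (+ n)) (sym diagonal-ab≡) ⟩
      + 5 * σ₃ n + σ₁ n - + 6 * θ σ₁ n + + 6 * diagonal-ab ∎)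
      where
      factor : ∀ w d → + 12 * w + + 6 * d ≡ + 6 * (+ 2 * w + d)
      factor = solve-∀
      split : ∀ l d x → l * (+ 5 * (d * d * d) - + 6 * (d * d) + d) ≡
        + 5 * (l * (d * d * d)) + l * d + - + 6 * (d * (l * (d * (+ 1 + x)))) +
        + 6 * (l * (x * (d * d)))
      split = solve-∀
      collect : ∀ l d n u v → u + l * d + - + 6 * (d * (l * n)) + v ≡
        (u + (1ℤ - + 6 * n) * (l * d)) + v
      collect = solve-∀
      expand : ∀ v s n → + 5 * v + (1ℤ - + 6 * n) * s ≡ + 5 * v + s - + 6 * (n * s)
      expand = solve-∀

  -- Partitions with bounded parts

  partitions≤ : ℕ → ℕ → List (List ℕ)
  partitions≤ m n = boundedPartitions n m n

  -- Parts are positive, so a bound on their number is inert once it reaches the total. Removing a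
  -- part `suc m` lowers this bound by only one; stability restores the form `partitions≤`.
  boundedPartitions-stable : ∀ ℓ ℓ′ m n → n ≤ ℓ → n ≤ ℓ′ →
    boundedPartitions ℓ m n ≡ boundedPartitions ℓ′ m n
  boundedPartitions-stable ℓ       ℓ′       m       zero    _ _ = refl
  boundedPartitions-stable (suc ℓ) (suc ℓ′) zero    (suc n) _ _ = refl
  boundedPartitions-stable (suc ℓ) (suc ℓ′) (suc m) (suc n) n≤ℓ@(s≤s p) n≤ℓ′@(s≤s q) with m ≤? n
  ... | no _  = boundedPartitions-stable (suc ℓ) (suc ℓ′) m (suc n) n≤ℓ n≤ℓ′
  ... | yes _ = cong₂ _++_
    (cong (map (suc m ∷_)) (boundedPartitions-stable ℓ ℓ′ (suc m) (n ∸ m)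
      (ℕₚ.≤-trans (ℕₚ.m∸n≤m n m) p) (ℕₚ.≤-trans (ℕₚ.m∸n≤m n m) q)))
    (boundedPartitions-stable (suc ℓ) (suc ℓ′) m (suc n) n≤ℓ n≤ℓ′)

  -- Either the part `suc m` is absent or one copy of it is removed. An arbitrary additive weight
  -- `w` lets one recurrence serve all partitions, the nuclear ones and those counted by γ.
  partitions≤-suc : (w : List (List ℕ) → ℤ) → (∀ xs ys → w (xs ++ ys) ≡ w xs + w ys) →
    ∀ m n → w (partitions≤ (suc m) n) ≡
      w (partitions≤ m n) + shift (suc m) (λ k → w (map (suc m ∷_) (partitions≤ (suc m) k))) n
  partitions≤-suc w w-++ m zero    = sym (ℤₚ.+-identityʳ _)
  partitions≤-suc w w-++ m (suc n) with m ≤? n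
  ... | no m≰n = sym (trans
    (cong (_+_ (w (partitions≤ m (suc n)))) (shift-< _ (ℕₚ.≰⇒> m≰n)))
    (ℤₚ.+-identityʳ _))
  ... | yes m≤n = begin
    w (map (suc m ∷_) (boundedPartitions n (suc m) (n ∸ m)) ++ partitions≤ m (suc n))
      ≡⟨ w-++ _ (partitions≤ m (suc n)) ⟩
    w (map (suc m ∷_) (boundedPartitions n (suc m) (n ∸ m))) + w (partitions≤ m (suc n))
      ≡⟨ ℤₚ.+-comm _ (w (partitions≤ m (suc n))) ⟩
    w (partitions≤ m (suc n)) + w (map (suc m ∷_) (boundedPartitions n (suc m) (n ∸ m)))
      ≡⟨ cong (λ xs → w (partitions≤ m (suc n)) + w (map (suc m ∷_) xs))
           (boundedPartitions-stable n (n ∸ m) (suc m) (n ∸ m) (ℕₚ.m∸n≤m n m) ℕₚ.≤-refl) ⟩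
    w (partitions≤ m (suc n)) + w (map (suc m ∷_) (partitions≤ (suc m) (n ∸ m)))
      ≡⟨ cong (_+_ (w (partitions≤ m (suc n)))) (shift-∸ _ m≤n) ⟨
    w (partitions≤ m (suc n)) +
      shift m (λ k → w (map (suc m ∷_) (partitions≤ (suc m) k))) n ∎

  -- Counting partitions with a decidable property

  module _ {P : Pred (List ℕ) 0ℓ} (P? : Decidable P) where

    count : List (List ℕ) → ℤ
    count xs = + length (filter P? xs)

    count-++ : ∀ xs ys → count (xs ++ ys) ≡ count xs + count ys
    count-++ xs ys = trans (cong (λ zs → + length zs) (filter-++ P? xs ys))
      (trans (cong +_ (length-++ (filter P? xs))) (ℤₚ.pos-+ (length (filter P? xs)) _))

    count-none : ∀ {xs} → All (λ x → ¬ P x) xs → count xs ≡ 0ℤ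
    count-none none = cong (λ zs → + length zs) (filter-none P? none)

  count-map : ∀ {P Q : Pred (List ℕ) 0ℓ} (P? : Decidable P) (Q? : Decidable Q) f →
    (∀ x → P (f x) ⇔ Q x) → ∀ xs → count P? (map f xs) ≡ count Q? xs
  count-map P? Q? f P⇔Q xs = cong +_ (lengths xs)
    where
    lengths : ∀ xs → length (filter P? (map f xs)) ≡ length (filter Q? xs)
    lengths []       = refl
    lengths (x ∷ xs) with P? (f x) | Q? x
    ... | yes _ | yes _ = cong suc (lengths xs)
    ... | no  _ | no  _ = lengths xs
    ... | yes p | no ¬q = contradiction (Equivalence.to (P⇔Q x) p) ¬q
    ... | no ¬p | yes q = contradiction (Equivalence.from (P⇔Q x) q) ¬p

  γ? : Decidable (λ μ → IsNuclear μ × EqualLargestTwo μ)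
  γ? μ = isNuclear? μ ×-dec equalLargestTwo? μ

  p≤ ν≤ γ≤ : ℕ → Series
  p≤ m n = + length (partitions≤ m n)
  ν≤ m n = count isNuclear? (partitions≤ m n)
  γ≤ m n = count γ? (partitions≤ m n)

  p≤-suc : ∀ m n → p≤ (suc m) n ≡ p≤ m n + shift (suc m) (p≤ (suc m)) n
  p≤-suc m n = trans
    (partitions≤-suc (λ xs → + length xs)
      (λ xs ys → trans (cong +_ (length-++ xs)) (ℤₚ.pos-+ (length xs) _)) m n)
    (cong (_+_ (p≤ m n)) (shift-cong (suc m)
      (λ k → cong +_ (length-map (suc m ∷_) (partitions≤ (suc m) k))) n))

  p≤-zero : p≤ 0 ≗ δ 0
  p≤-zero zero    = refl
  p≤-zero (suc n) = refl

  ν≤-one : ν≤ 1 ≗ δ 0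
  ν≤-one n = begin
    ν≤ 1 n
      ≡⟨ partitions≤-suc (count isNuclear?) (count-++ isNuclear?) 0 n ⟩
    ν≤ 0 n + shift 1 (λ k → count isNuclear? (map (1 ∷_) (partitions≤ 1 k))) n
      ≡⟨ cong (_+_ (ν≤ 0 n)) (trans
           (shift-cong 1 (λ k → count-none isNuclear?
             (All.map⁺ (tabulate {xs = partitions≤ 1 k} (λ _ → λ { (1≢1 ∷ _) → 1≢1 refl })))) n)
           (shift-zero 1 n)) ⟩
    ν≤ 0 n + 0ℤ
      ≡⟨ ℤₚ.+-identityʳ (ν≤ 0 n) ⟩
    ν≤ 0 n
      ≡⟨ ν≤-zero n ⟩
    δ 0 n ∎
    where
    ν≤-zero : ν≤ 0 ≗ δ 0
    ν≤-zero zero    = refl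
    ν≤-zero (suc n) = refl

  ν≤-suc : ∀ m n → ν≤ (suc (suc m)) n ≡ ν≤ (suc m) n + shift (suc (suc m)) (ν≤ (suc (suc m))) n
  ν≤-suc m n = trans
    (partitions≤-suc (count isNuclear?) (count-++ isNuclear?) (suc m) n)
    (cong (_+_ (ν≤ (suc m) n)) (shift-cong (suc (suc m))
      (λ k → count-map isNuclear? isNuclear? (suc (suc m) ∷_)
        (λ μ → mk⇔ (λ { (_ ∷ nuc) → nuc }) ((λ ()) ∷_)) (partitions≤ (suc (suc m)) k)) n))

  γ≤-one : ∀ n → γ≤ 1 n ≡ 0ℤ
  γ≤-one n = begin
    γ≤ 1 n
      ≡⟨ partitions≤-suc (count γ?) (count-++ γ?) 0 n ⟩
    γ≤ 0 n + shift 1 (λ k → count γ? (map (1 ∷_) (partitions≤ 1 k))) n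
      ≡⟨ cong₂ _+_ (γ≤-zero n) (trans
           (shift-cong 1 (λ k → count-none γ?
             (All.map⁺ (tabulate {xs = partitions≤ 1 k} (λ _ → λ { (1≢1 ∷ _ , _) → 1≢1 refl })))) n)
           (shift-zero 1 n)) ⟩
    0ℤ ∎
    where
    γ≤-zero : ∀ n → γ≤ 0 n ≡ 0ℤ
    γ≤-zero zero    = refl
    γ≤-zero (suc n) = refl

  -- Two copies of the part d are split off from a partition whose largest part is d.
  γ≤-suc : ∀ m n → let d = suc (suc m) in
    γ≤ d n ≡ γ≤ (suc m) n + shift d (shift d (ν≤ d)) n
  γ≤-suc m n = trans
    (partitions≤-suc (count γ?) (count-++ γ?) (suc m) n)
    (cong (_+_ (γ≤ (suc m) n)) (shift-cong d with-d n))
    where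
    d : ℕ
    d = suc (suc m)
    none : ∀ k → count γ? (map (d ∷_) (partitions≤ (suc m) k)) ≡ 0ℤ
    none k = count-none γ? (All.map⁺ (tabulate excluded))
      where
      excluded : ∀ {μ} → μ ∈ partitions≤ (suc m) k → ¬ (IsNuclear (d ∷ μ) × EqualLargestTwo (d ∷ μ))
      excluded {[]}    μ∈ (_ , ())
      excluded {a ∷ μ} μ∈ (_ , refl) with boundedPartitions-sound k (suc m) k μ∈
      ... | d≤m ∷ _ , _ = ℕₚ.1+n≰n d≤m
    with-d : ∀ k → count γ? (map (d ∷_) (partitions≤ d k)) ≡ shift d (ν≤ d) k
    with-d k = begin
      count γ? (map (d ∷_) (partitions≤ d k))
        -- The recurrence is applied again below the first `d`: a next part smaller than `d`, or
        -- none, is disqualified, while a second `d` leaves only nuclearity to be checked.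
        ≡⟨ partitions≤-suc (λ xs → count γ? (map (d ∷_) xs)) additive (suc m) k ⟩
      count γ? (map (d ∷_) (partitions≤ (suc m) k)) +
        shift d (λ j → count γ? (map (d ∷_) (map (d ∷_) (partitions≤ d j)))) k
        ≡⟨ cong₂ _+_ (none k) (shift-cong d (λ j → trans
             (cong (count γ?) (sym (map-∘ (partitions≤ d j))))
             (count-map γ? isNuclear? (λ μ → d ∷ d ∷ μ)
               (λ μ → mk⇔ (λ { (_ ∷ _ ∷ nuc , _) → nuc }) (λ nuc → (λ ()) ∷ (λ ()) ∷ nuc , refl))
               (partitions≤ d j))) k) ⟩
      0ℤ + shift d (ν≤ d) k
        ≡⟨ ℤₚ.+-identityˡ _ ⟩
      shift d (ν≤ d) k ∎
      where
      additive : ∀ xs ys → count γ? (map (d ∷_) (xs ++ ys)) ≡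
        count γ? (map (d ∷_) xs) + count γ? (map (d ∷_) ys)
      additive xs ys = trans (cong (count γ?) (map-++ (d ∷_) xs ys)) (count-++ γ? (map (d ∷_) xs) _)

  -- Σ_{2≤k≤m} q²ᵏ ν≤ k telescopes, as qᵏ ν≤ k = ν≤ k − ν≤ (k − 1).
  γ≤-ν≤ : ∀ m n → γ≤ (suc m) n + shift 1 (ν≤ (suc m)) n + δ 0 n + δ 2 n ≡
    ν≤ (suc m) n + δ 1 n + shift (suc (suc m)) (ν≤ (suc m)) n
  -- The terms 1, q and q² are boundary values of the telescoping, coming from `ν≤ 1` being the
  -- series 1. They vanish from exponent 3 on.
  γ≤-ν≤ zero n = begin
    γ≤ 1 n + shift 1 (ν≤ 1) n + δ 0 n + δ 2 n
      ≡⟨ cong₂ (λ s t → s + t + δ 0 n + δ 2 n) (γ≤-one n)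
           (trans (shift-cong 1 ν≤-one n) (δ-+ 1 0 n)) ⟩
    0ℤ + δ 1 n + δ 0 n + δ 2 n
      ≡⟨ reorder (δ 0 n) (δ 1 n) (δ 2 n) ⟩
    δ 0 n + δ 1 n + δ 2 n
      ≡⟨ cong₂ (λ s t → s + δ 1 n + t) (ν≤-one n) (trans (shift-cong 2 ν≤-one n) (δ-+ 2 0 n)) ⟨
    ν≤ 1 n + δ 1 n + shift 2 (ν≤ 1) n ∎
    where
    reorder : ∀ a b c → 0ℤ + b + a + c ≡ a + b + c
    reorder = solve-∀
  γ≤-ν≤ (suc m) n = begin
    γ≤ d n + shift 1 (ν≤ d) n + δ 0 n + δ 2 n
      ≡⟨ cong₂ (λ s t → s + t + δ 0 n + δ 2 n) (γ≤-suc m n) (split 1) ⟩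
    γ≤ (suc m) n + dd + (shift 1 (ν≤ (suc m)) n + shift 1 (shift d (ν≤ d)) n) + δ 0 n + δ 2 n
      ≡⟨ regroup (γ≤ (suc m) n) dd (shift 1 (ν≤ (suc m)) n) _ (δ 0 n) (δ 2 n) ⟩
    γ≤ (suc m) n + shift 1 (ν≤ (suc m)) n + δ 0 n + δ 2 n + dd + shift 1 (shift d (ν≤ d)) n
      ≡⟨ cong₂ (λ s t → s + dd + t) (γ≤-ν≤ m n) (shift-shift 1 d (ν≤ d) n) ⟩
    ν≤ (suc m) n + δ 1 n + shift d (ν≤ (suc m)) n + dd + shift (suc d) (ν≤ d) n
      ≡⟨ cong (_+ shift (suc d) (ν≤ d) n) (trans
           (ℤₚ.+-assoc (ν≤ (suc m) n + δ 1 n) _ dd)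
           (cong (_+_ (ν≤ (suc m) n + δ 1 n)) (sym (split d)))) ⟩
    ν≤ (suc m) n + δ 1 n + shift d (ν≤ d) n + shift (suc d) (ν≤ d) n
      ≡⟨ swap (ν≤ (suc m) n) (δ 1 n) (shift d (ν≤ d) n) (shift (suc d) (ν≤ d) n) ⟩
    ν≤ (suc m) n + shift d (ν≤ d) n + δ 1 n + shift (suc d) (ν≤ d) n
      ≡⟨ cong (λ s → s + δ 1 n + shift (suc d) (ν≤ d) n) (ν≤-suc m n) ⟨
    ν≤ d n + δ 1 n + shift (suc d) (ν≤ d) n ∎
    where
    d : ℕ
    d = suc (suc m)
    dd : ℤ
    dd = shift d (shift d (ν≤ d)) n
    split : ∀ e → shift e (ν≤ d) n ≡ shift e (ν≤ (suc m)) n + shift e (shift d (ν≤ d)) n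
    split e = trans (shift-cong e (ν≤-suc m) n) (shift-distrib e (ν≤ (suc m)) _ n)
    regroup : ∀ g x a b u v → g + x + (a + b) + u + v ≡ g + a + u + v + x + b
    regroup = solve-∀
    swap : ∀ a b c e → a + b + c + e ≡ a + c + b + e
    swap = solve-∀

  -- A partition without a part 1 is nuclear; otherwise one part 1 can be removed. The proof avoids
  -- this bijection: both sides solve the same equation F = `p≤ (suc m)` + qᵈ F.
  p≤-ν≤ : ∀ m n → p≤ (suc m) n ≡ ν≤ (suc m) n + shift 1 (p≤ (suc m)) n
  p≤-ν≤ zero n = trans (p≤-suc 0 n)
    (cong (_+ shift 1 (p≤ 1) n) (trans (p≤-zero n) (sym (ν≤-one n))))
  p≤-ν≤ (suc m) = shift-unique (suc m) (p≤ d) _ (p≤ (suc m)) (p≤-suc (suc m)) λ n → begin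
    ν≤ d n + shift 1 (p≤ d) n
      ≡⟨ cong₂ _+_ (ν≤-suc m n)
           (trans (shift-cong 1 (p≤-suc (suc m)) n) (shift-distrib 1 (p≤ (suc m)) _ n)) ⟩
    (ν≤ (suc m) n + shift d (ν≤ d) n) + (shift 1 (p≤ (suc m)) n + shift 1 (shift d (p≤ d)) n)
      ≡⟨ interchange (ν≤ (suc m) n) (shift d (ν≤ d) n) (shift 1 (p≤ (suc m)) n) _ ⟩
    (ν≤ (suc m) n + shift 1 (p≤ (suc m)) n) + (shift d (ν≤ d) n + shift 1 (shift d (p≤ d)) n)
      ≡⟨ cong₂ _+_ (sym (p≤-ν≤ m n)) (trans
           (cong (_+_ (shift d (ν≤ d) n)) (shift-comm 1 d (p≤ d) n))
           (sym (shift-distrib d (ν≤ d) _ n))) ⟩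
    p≤ (suc m) n + shift d (λ i → ν≤ d i + shift 1 (p≤ d) i) n ∎
    where
    d : ℕ
    d = suc (suc m)
    interchange : ∀ a b c e → (a + b) + (c + e) ≡ (a + c) + (b + e)
    interchange = solve-∀

  -- From bounded to unrestricted partitions

  p : Series
  p n = p≤ n n

  p≤-p : ∀ {m n} → n ≤ m → p≤ m n ≡ p n
  p≤-p n≤m = go (ℕₚ.≤⇒≤′ n≤m)
    where
    go : ∀ {m n} → n ℕ.≤′ m → p≤ m n ≡ p n
    go {m} (ℕ.≤′-reflexive refl) = refl
    go {suc m} {n} (ℕ.≤′-step n≤′m) = begin
      p≤ (suc m) n                              ≡⟨ p≤-suc m n ⟩
      p≤ m n + shift (suc m) (p≤ (suc m)) n
        ≡⟨ cong₂ _+_ (go n≤′m) (shift-< (p≤ (suc m)) (s≤s (ℕₚ.≤′⇒≤ n≤′m))) ⟩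
      p n + 0ℤ                                  ≡⟨ ℤₚ.+-identityʳ (p n) ⟩
      p n                                       ∎

  γ-p : ∀ n → + γ (3 ℕ.+ n) ≡ p (3 ℕ.+ n) - + 2 * p (2 ℕ.+ n) + p (1 ℕ.+ n)
  γ-p n = begin
    + γ N
      -- `+ γ N` is `γ≤ N N` by computation, and the zeros are `δ 0 N` and `δ 2 N`, as N ≥ 3. The
      -- part bound stays N at all lower exponents so that the bounded identities apply.
      ≡⟨ isolate (+ γ N) (ν≤ N (2 ℕ.+ n)) ⟩
    (+ γ N + ν≤ N (2 ℕ.+ n) + 0ℤ + 0ℤ) - ν≤ N (2 ℕ.+ n)
      ≡⟨ cong (_- ν≤ N (2 ℕ.+ n)) (γ≤-ν≤ (2 ℕ.+ n) N) ⟩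
    (ν≤ N N + 0ℤ + shift (suc N) (ν≤ N) N) - ν≤ N (2 ℕ.+ n)
      -- The end term of the telescoping starts at exponent N + 1, just out of reach.
      ≡⟨ cong (λ s → (ν≤ N N + 0ℤ + s) - ν≤ N (2 ℕ.+ n)) (shift-< {suc N} (ν≤ N) ℕₚ.≤-refl) ⟩
    (ν≤ N N + 0ℤ + 0ℤ) - ν≤ N (2 ℕ.+ n)
      ≡⟨ differences (ν≤ N N) (p≤ N (2 ℕ.+ n)) (ν≤ N (2 ℕ.+ n)) (p≤ N (1 ℕ.+ n)) ⟩
    (ν≤ N N + p≤ N (2 ℕ.+ n)) - p≤ N (2 ℕ.+ n) - (ν≤ N (2 ℕ.+ n) + p≤ N (1 ℕ.+ n)) + p≤ N (1 ℕ.+ n)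
      ≡⟨ cong₂ (λ s t → s - p≤ N (2 ℕ.+ n) - t + p≤ N (1 ℕ.+ n))
           (sym (p≤-ν≤ (2 ℕ.+ n) N)) (sym (p≤-ν≤ (2 ℕ.+ n) (2 ℕ.+ n))) ⟩
    p N - p≤ N (2 ℕ.+ n) - p≤ N (2 ℕ.+ n) + p≤ N (1 ℕ.+ n)
      ≡⟨ cong₂ (λ s t → p N - s - s + t) (p≤-p (ℕₚ.n≤1+n (2 ℕ.+ n))) (p≤-p (ℕₚ.m≤n+m (1 ℕ.+ n) 2)) ⟩
    p N - p (2 ℕ.+ n) - p (2 ℕ.+ n) + p (1 ℕ.+ n)
      ≡⟨ collect (p N) (p (2 ℕ.+ n)) (p (1 ℕ.+ n)) ⟩
    p N - + 2 * p (2 ℕ.+ n) + p (1 ℕ.+ n) ∎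
    where
    N : ℕ
    N = 3 ℕ.+ n
    isolate : ∀ a b → a ≡ (a + b + 0ℤ + 0ℤ) - b
    isolate = solve-∀
    differences : ∀ a x b y → (a + 0ℤ + 0ℤ) - b ≡ (a + x) - x - (b + y) + y
    differences = solve-∀
    collect : ∀ a b c → a - b - b + c ≡ a - + 2 * b + c
    collect = solve-∀

  -- The logarithmic derivative of the partition series

  -- qᵈ / (1 − qᵈ)
  multiples : ℕ → Series
  multiples d n = ∑[ x < n ] δ (d ℕ.* suc x) n

  multiples-shift : ∀ e n → let d = suc e in
    multiples d n ≡ shift d (δ 0) n + shift d (multiples d) n
  multiples-shift e n with suc e ≤? n
  ... | no d≰n = trans
    (∑-zero n (λ x → δ-> (ℕₚ.<-≤-trans (ℕₚ.≰⇒> d≰n) (ℕₚ.m≤m*n (suc e) (suc x)))))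
    (sym (cong₂ _+_ (shift-< (δ 0) (ℕₚ.≰⇒> d≰n)) (shift-< (multiples (suc e)) (ℕₚ.≰⇒> d≰n))))
  ... | yes d≤n = subst (λ n → multiples d n ≡ shift d (δ 0) n + shift d (multiples d) n)
    (ℕₚ.m+[n∸m]≡n d≤n) (at (n ∸ d))
    where
    d : ℕ
    d = suc e
    at : ∀ k → multiples d (d ℕ.+ k) ≡ shift d (δ 0) (d ℕ.+ k) + shift d (multiples d) (d ℕ.+ k)
    at k = begin
      ∑[ x < d ℕ.+ k ] δ (d ℕ.* suc x) (d ℕ.+ k)
        ≡⟨ ∑-cong (d ℕ.+ k) (λ x → trans
             (cong (λ l → δ l (d ℕ.+ k)) (ℕₚ.*-suc d x)) (δ-cancel d (d ℕ.* x) k)) ⟩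
      ∑[ x < d ℕ.+ k ] δ (d ℕ.* x) k
        -- Terms with x > k vanish because d x > k; what is left is x = 0, giving qᵈ, and the sum
        -- that defines the series at exponent `k`.
        ≡⟨ ∑-extend (s≤s (ℕₚ.m≤n+m k e)) (λ x k<x → δ-> (ℕₚ.≤-trans k<x (ℕₚ.m≤n*m x d))) ⟩
      δ (d ℕ.* 0) k + ∑[ x < k ] δ (d ℕ.* suc x) k
        ≡⟨ cong (λ l → δ l k + multiples d k) (ℕₚ.*-zeroʳ d) ⟩
      δ 0 k + multiples d k
        ≡⟨ cong₂ _+_ (shift-≥ d k (δ 0)) (shift-≥ d k (multiples d)) ⟨
      shift d (δ 0) (d ℕ.+ k) + shift d (multiples d) (d ℕ.+ k) ∎

  -- The Lambert series Σ a qᵃ / (1 - qᵃ) over a ≤ m, truncated to match the factors of the product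
  -- for `p≤ m`.
  σ≤ : ℕ → Series
  σ≤ zero    n = 0ℤ
  σ≤ (suc m) n = σ≤ m n + + suc m * multiples (suc m) n

  σ≤-σ₁ : ∀ {m n} → n ≤ m → σ≤ m n ≡ σ₁ n
  σ≤-σ₁ {m} {n} n≤m = begin
    σ≤ m n
      ≡⟨ unfold m ⟩
    ∑[ a < m ] ∑[ x < n ] δ (suc a ℕ.* suc x) n * + suc a
      ≡⟨ ∑-extend n≤m (λ a n≤a → ∑-zero n (λ x → δ-≥ n≤a (ℕₚ.m≤m*n (suc a) (suc x)) _)) ⟩
    σ₁ n ∎
    where
    unfold : ∀ m → σ≤ m n ≡ ∑[ a < m ] ∑[ x < n ] δ (suc a ℕ.* suc x) n * + suc a
    unfold zero    = refl
    unfold (suc m) = trans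
      (cong₂ _+_ (unfold m) (trans
        (sym (∑-*ˡ n (+ suc m) (λ x → δ (suc m ℕ.* suc x) n)))
        (∑-cong n (λ x → ℤₚ.*-comm (+ suc m) (δ (suc m ℕ.* suc x) n)))))
      (sym (∑-snoc m _))

  -- The logarithmic derivative of Π (1 − qᵏ)⁻¹, one factor at a time.
  θp≤ : ∀ m → θ (p≤ m) ≗ σ≤ m ⊛ p≤ m
  θp≤ zero    n = trans (vanish n) (sym (⊛-zeroˡ (p≤ 0) n))
    where
    vanish : ∀ n → θ (p≤ 0) n ≡ 0ℤ
    vanish zero    = refl
    vanish (suc n) = ℤₚ.*-zeroʳ (+ suc n)
  -- Both sides solve F = R + qᵈ F, where R is what remains of θ applied to `p≤-suc` after qᵈ θP is
  -- set aside.
  θp≤ (suc m) = shift-unique m (θ P) (σ≤ d ⊛ P) R θP-shift σP-shift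
    where
    d : ℕ
    d = suc m
    P E R : Series
    P = p≤ d
    E = multiples d
    R n = θ (p≤ m) n + + d * shift d P n
    θP-shift : ∀ n → θ P n ≡ R n + shift d (θ P) n
    θP-shift n = begin
      + n * P n
        ≡⟨ cong (_*_ (+ n)) (p≤-suc m n) ⟩
      + n * (p≤ m n + shift d P n)
        ≡⟨ ℤₚ.*-distribˡ-+ (+ n) (p≤ m n) (shift d P n) ⟩
      θ (p≤ m) n + θ (shift d P) n
        ≡⟨ cong (_+_ (θ (p≤ m) n)) (θ-shift d P n) ⟩
      θ (p≤ m) n + (+ d * shift d P n + shift d (θ P) n)
        ≡⟨ ℤₚ.+-assoc (θ (p≤ m) n) (+ d * shift d P n) (shift d (θ P) n) ⟨
      R n + shift d (θ P) n ∎
    σm⊛P : ∀ n → (σ≤ m ⊛ P) n ≡ θ (p≤ m) n + shift d (σ≤ m ⊛ P) n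
    σm⊛P n = begin
      (σ≤ m ⊛ P) n
        ≡⟨ ⊛-congˡ (σ≤ m) (p≤-suc m) n ⟩
      (σ≤ m ⊛ (λ i → p≤ m i + shift d P i)) n
        ≡⟨ ⊛-distribˡ (σ≤ m) (p≤ m) (shift d P) n ⟩
      (σ≤ m ⊛ p≤ m) n + (σ≤ m ⊛ shift d P) n
        ≡⟨ cong₂ _+_ (sym (θp≤ m n)) (shift-⊛ʳ d (σ≤ m) P n) ⟩
      θ (p≤ m) n + shift d (σ≤ m ⊛ P) n ∎
    E⊛P : ∀ n → (E ⊛ P) n ≡ shift d P n + shift d (E ⊛ P) n
    E⊛P n = begin
      (E ⊛ P) n
        ≡⟨ ⊛-congʳ P (multiples-shift m) n ⟩
      ((λ i → shift d (δ 0) i + shift d E i) ⊛ P) n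
        ≡⟨ ⊛-distribʳ (shift d (δ 0)) (shift d E) P n ⟩
      (shift d (δ 0) ⊛ P) n + (shift d E ⊛ P) n
        ≡⟨ cong₂ _+_ (trans (shift-⊛ˡ d (δ 0) P n) (shift-cong d (δ-⊛ 0 P) n)) (shift-⊛ˡ d E P n) ⟩
      shift d P n + shift d (E ⊛ P) n ∎
    σd⊛P : ∀ n → (σ≤ d ⊛ P) n ≡ (σ≤ m ⊛ P) n + + d * (E ⊛ P) n
    σd⊛P n = trans (⊛-distribʳ (σ≤ m) _ P n) (cong (_+_ ((σ≤ m ⊛ P) n)) (⊛-scaleˡ (+ d) E P n))
    σP-shift : ∀ n → (σ≤ d ⊛ P) n ≡ R n + shift d (σ≤ d ⊛ P) n
    σP-shift n = begin
      (σ≤ d ⊛ P) n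
        ≡⟨ σd⊛P n ⟩
      (σ≤ m ⊛ P) n + + d * (E ⊛ P) n
        ≡⟨ cong₂ (λ s t → s + + d * t) (σm⊛P n) (E⊛P n) ⟩
      (θ (p≤ m) n + shift d (σ≤ m ⊛ P) n) + + d * (shift d P n + shift d (E ⊛ P) n)
        ≡⟨ regroup (θ (p≤ m) n) (shift d (σ≤ m ⊛ P) n) (+ d) (shift d P n) (shift d (E ⊛ P) n) ⟩
      R n + (shift d (σ≤ m ⊛ P) n + + d * shift d (E ⊛ P) n)
        ≡⟨ cong (_+_ (R n)) (trans (shift-cong d σd⊛P n) (trans
             (shift-distrib d (σ≤ m ⊛ P) _ n)
             (cong (_+_ (shift d (σ≤ m ⊛ P) n)) (shift-scale d (+ d) (E ⊛ P) n)))) ⟨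
      R n + shift d (σ≤ d ⊛ P) n ∎
      where
      regroup : ∀ a b d x y → (a + b) + d * (x + y) ≡ (a + d * x) + (b + d * y)
      regroup = solve-∀

  -- Coefficient `n` of the product consults only exponents up to `n`, where the truncation at m = n
  -- is already exact.
  θp : θ p ≗ σ₁ ⊛ p
  θp n = trans (θp≤ n n) (⊛-cong-≤ n (λ i → σ≤-σ₁) (λ i → p≤-p))

  -- Ramanujan's congruence modulo 5

  σᵏp : ℕ → Series
  σᵏp zero    = p
  σᵏp (suc k) = σ₁ ⊛ σᵏp k

  -- Collects the σ₃ terms that the Leibniz rule produces. Only integrality of these values is used
  -- later, as they occur multiplied by 5.
  remainder : ℕ → Series
  remainder zero    n = 0ℤ
  remainder (suc k) n = (σ₃ ⊛ σᵏp k) n + (σ₁ ⊛ remainder k) n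

  6*θσ₁⊛ : ∀ g n → + 6 * (θ σ₁ ⊛ g) n ≡
    + 5 * (σ₃ ⊛ g) n + (σ₁ ⊛ g) n + - + 12 * (σ₁ ⊛ (σ₁ ⊛ g)) n
  6*θσ₁⊛ g n = begin
    + 6 * (θ σ₁ ⊛ g) n
      ≡⟨ ⊛-scaleˡ (+ 6) (θ σ₁) g n ⟨
    ((λ i → + 6 * θ σ₁ i) ⊛ g) n
      ≡⟨ ⊛-congʳ g (λ i → trans (solve-for (+ 6 * θ σ₁ i) (+ 5 * σ₃ i) (σ₁ i))
           (cong (λ s → + 5 * σ₃ i + σ₁ i + - s) (sym (σ₁⊛σ₁-formula i)))) n ⟩
    ((λ i → + 5 * σ₃ i + σ₁ i + - (+ 12 * (σ₁ ⊛ σ₁) i)) ⊛ g) n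
      ≡⟨ ⊛-congʳ g (λ i → cong (_+_ (+ 5 * σ₃ i + σ₁ i))
           (ℤₚ.neg-distribˡ-* (+ 12) ((σ₁ ⊛ σ₁) i))) n ⟩
    ((λ i → + 5 * σ₃ i + σ₁ i + - + 12 * (σ₁ ⊛ σ₁) i) ⊛ g) n
      ≡⟨ ⊛-distribʳ _ _ g n ⟩
    ((λ i → + 5 * σ₃ i + σ₁ i) ⊛ g) n + ((λ i → - + 12 * (σ₁ ⊛ σ₁) i) ⊛ g) n
      ≡⟨ cong₂ _+_
           (trans (⊛-distribʳ _ σ₁ g n) (cong (_+ (σ₁ ⊛ g) n) (⊛-scaleˡ (+ 5) σ₃ g n)))
           (trans (⊛-scaleˡ (- + 12) (σ₁ ⊛ σ₁) g n) (cong (_*_ (- + 12)) (⊛-assoc σ₁ σ₁ g n))) ⟩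
    + 5 * (σ₃ ⊛ g) n + (σ₁ ⊛ g) n + - + 12 * (σ₁ ⊛ (σ₁ ⊛ g)) n ∎
    where
    solve-for : ∀ t a b → t ≡ a + b + - (a + b - t)
    solve-for = solve-∀

  -- By the Leibniz rule each of the k factors σ₁ contributes 5 σ₃ + σ₁ - 12 σ₁² in place of σ₁, and
  -- p contributes 6 σ₁ p.
  6*θσᵏp : ∀ k n → + 6 * θ (σᵏp k) n ≡
    + 5 * remainder k n + + k * σᵏp k n + (+ 6 - + 12 * + k) * σᵏp (suc k) n
  6*θσᵏp zero n = trans (cong (_*_ (+ 6)) (θp n)) (pad (p n) ((σ₁ ⊛ p) n))
    where
    pad : ∀ x y → + 6 * y ≡ + 5 * 0ℤ + + 0 * x + (+ 6 - + 12 * + 0) * y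
    pad = solve-∀
  6*θσᵏp (suc k) n = begin
    + 6 * θ (σ₁ ⊛ f) n
      ≡⟨ trans (cong (_*_ (+ 6)) (θ-⊛ σ₁ f n)) (ℤₚ.*-distribˡ-+ (+ 6) ((θ σ₁ ⊛ f) n) _) ⟩
    + 6 * (θ σ₁ ⊛ f) n + + 6 * (σ₁ ⊛ θ f) n
      ≡⟨ cong₂ _+_ (6*θσ₁⊛ f n) (begin
           + 6 * (σ₁ ⊛ θ f) n
             ≡⟨ ⊛-scaleʳ (+ 6) σ₁ (θ f) n ⟨
           (σ₁ ⊛ (λ i → + 6 * θ f i)) n
             ≡⟨ ⊛-congˡ σ₁ (6*θσᵏp k) n ⟩
           (σ₁ ⊛ (λ i → + 5 * remainder k i + + k * f i + c * σᵏp (suc k) i)) n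
             ≡⟨ ⊛-distribˡ σ₁ _ _ n ⟩
           (σ₁ ⊛ (λ i → + 5 * remainder k i + + k * f i)) n + (σ₁ ⊛ (λ i → c * σᵏp (suc k) i)) n
             ≡⟨ cong₂ _+_ (trans (⊛-distribˡ σ₁ _ _ n)
                  (cong₂ _+_ (⊛-scaleʳ (+ 5) σ₁ (remainder k) n) (⊛-scaleʳ (+ k) σ₁ f n)))
                  (⊛-scaleʳ c σ₁ (σᵏp (suc k)) n) ⟩
           + 5 * (σ₁ ⊛ remainder k) n + + k * σᵏp (suc k) n + c * σᵏp (suc (suc k)) n ∎) ⟩
    (+ 5 * (σ₃ ⊛ f) n + σᵏp (suc k) n + - + 12 * σᵏp (suc (suc k)) n) +
      (+ 5 * (σ₁ ⊛ remainder k) n + + k * σᵏp (suc k) n + c * σᵏp (suc (suc k)) n)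
      ≡⟨ collect ((σ₃ ⊛ f) n) ((σ₁ ⊛ remainder k) n) (σᵏp (suc k) n) (σᵏp (suc (suc k)) n) (+ k) ⟩
    + 5 * remainder (suc k) n + + suc k * σᵏp (suc k) n +
      (+ 6 - + 12 * + suc k) * σᵏp (suc (suc k)) n ∎
    where
    f : Series
    f = σᵏp k
    c : ℤ
    c = + 6 - + 12 * + k
    collect : ∀ v h y z k →
      (+ 5 * v + y + - + 12 * z) + (+ 5 * h + k * y + (+ 6 - + 12 * k) * z) ≡
      + 5 * (v + h) + (+ 1 + k) * y + (+ 6 - + 12 * (+ 1 + k)) * z
    collect = solve-∀

  -- u and t witness that 6 (5n + 4) − k ≡ 24 − k is invertible modulo 5.
  5∣-descend : ∀ u t k n h w x → u * (+ 24 - k) ≡ + 1 + + 5 * t →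
    + 6 * ((+ 4 + + 5 * n) * x) ≡ + 5 * h + k * x + + 5 * w → + 5 ℤ∣.∣ x
  5∣-descend u t k n h w x inv eq = ℤ∣.divides (u * (h + w - + 6 * n * x) - t * x) (begin
    x
      ≡⟨ reduce t x ⟩
    (+ 1 + + 5 * t) * x - + 5 * t * x
      ≡⟨ cong (λ s → s * x - + 5 * t * x) inv ⟨
    u * (+ 24 - k) * x - + 5 * t * x
      ≡⟨ expose u t k n x ⟩
    u * (+ 6 * ((+ 4 + + 5 * n) * x) - k * x - + 30 * n * x) - + 5 * t * x
      ≡⟨ cong (λ s → u * (s - k * x - + 30 * n * x) - + 5 * t * x) eq ⟩
    u * (+ 5 * h + k * x + + 5 * w - k * x - + 30 * n * x) - + 5 * t * x
      ≡⟨ factor u t k n h w x ⟩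
    (u * (h + w - + 6 * n * x) - t * x) * + 5 ∎)
    where
    reduce : ∀ t x → x ≡ (+ 1 + + 5 * t) * x - + 5 * t * x
    reduce = solve-∀
    expose : ∀ u t k n x → u * (+ 24 - k) * x - + 5 * t * x ≡
      u * (+ 6 * ((+ 4 + + 5 * n) * x) - k * x - + 30 * n * x) - + 5 * t * x
    expose = solve-∀
    factor : ∀ u t k n h w x →
      u * (+ 5 * h + k * x + + 5 * w - k * x - + 30 * n * x) - + 5 * t * x ≡
      (u * (h + w - + 6 * n * x) - t * x) * + 5
    factor = solve-∀

  module _ (n : ℕ) where

    private
      N : ℕ
      N = 4 ℕ.+ 5 ℕ.* n

      equation : ∀ k → + 6 * ((+ 4 + + 5 * + n) * σᵏp k N) ≡
        + 5 * remainder k N + + k * σᵏp k N + (+ 6 - + 12 * + k) * σᵏp (suc k) N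
      equation k = trans
        (cong (λ s → + 6 * ((+ 4 + s) * σᵏp k N)) (sym (ℤₚ.pos-* 5 n)))
        (6*θσᵏp k N)

      -- At exponent N the equation reads (24 - k) σ₁ᵏ p ≡ (6 - 12 k) σ₁ᵏ⁺¹ p modulo 5, so
      -- divisibility passes from k + 1 to k when 24 - k is invertible.
      step : ∀ u t k → u * (+ 24 - + k) ≡ + 1 + + 5 * t →
        + 5 ℤ∣.∣ σᵏp (suc k) N → + 5 ℤ∣.∣ σᵏp k N
      step u t k inv (ℤ∣.divides q eq) =
        5∣-descend u t (+ k) (+ n) (remainder k N) ((+ 6 - + 12 * + k) * q) (σᵏp k N) inv
          (trans (equation k) (cong (_+_ (+ 5 * remainder k N + + k * σᵏp k N))
            (trans (cong (_*_ (+ 6 - + 12 * + k)) eq) (move (+ 6 - + 12 * + k) q))))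
        where
        move : ∀ c q → c * (q * + 5) ≡ + 5 * (c * q)
        move = solve-∀

      -- The descent starts at k = 3, where the coefficient 6 − 12k = −30 is divisible by 5.
      5∣σ³p : + 5 ℤ∣.∣ σᵏp 3 N
      5∣σ³p = 5∣-descend (+ 1) (+ 4) (+ 3) (+ n) (remainder 3 N) (- + 6 * σᵏp 4 N) (σᵏp 3 N) refl
        (trans (equation 3) (cong (_+_ (+ 5 * remainder 3 N + + 3 * σᵏp 3 N)) (move (σᵏp 4 N))))
        where
        move : ∀ z → (+ 6 - + 12 * + 3) * z ≡ + 5 * (- + 6 * z)
        move = solve-∀

    ramanujan : + 5 ℤ∣.∣ p (4 ℕ.+ 5 ℕ.* n)
    -- The inverses are read off from 4 · 24 = 1 + 5 · 19, 2 · 23 = 1 + 5 · 9 and 3 · 22 = 1 + 5 ·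
    -- 13.
    ramanujan = step (+ 4) (+ 19) 0 refl (step (+ 2) (+ 9) 1 refl (step (+ 3) (+ 13) 2 refl 5∣σ³p))

  -- The weighted sum of values of γ

  5∣γ-combination : ∀ n → + 5 ℤ∣.∣
    + (γ (5 ℕ.* suc n ℕ.+ 1) ℕ.+ 2 ℕ.* γ (5 ℕ.* suc n ℕ.+ 2) ℕ.+
       3 ℕ.* γ (5 ℕ.* suc n ℕ.+ 3) ℕ.+ 4 ℕ.* γ (5 ℕ.* suc n ℕ.+ 4))
  5∣γ-combination n = subst (+ 5 ℤ∣.∣_) (sym total)
    (ℤ∣.∣m∣n⇒∣m+n (ramanujan n) (ℤ∣.∣m∣n⇒∣m-n
      (ℤ∣.∣n⇒∣m*n (+ 4) (subst (λ i → + 5 ℤ∣.∣ p i) (next n) (ramanujan (suc n))))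
      (ℤ∣.∣m⇒∣m*n (p (5 ℕ.+ e)) ℤ∣.∣-refl)))
    where
    e : ℕ
    e = 3 ℕ.+ 5 ℕ.* n
    next : ∀ n → 4 ℕ.+ 5 ℕ.* suc n ≡ 9 ℕ.+ 5 ℕ.* n
    next = ℕ-Solver.solve-∀
    -- `γ-p` speaks of arguments of the form 3 + i; the bound n ≥ 1 of the theorem, present as
    -- `suc n`, provides it.
    index : ∀ j → 5 ℕ.* suc n ℕ.+ suc j ≡ 3 ℕ.+ j ℕ.+ e
    index j = reindex n j
      where
      reindex : ∀ n j → 5 ℕ.* suc n ℕ.+ suc j ≡ 3 ℕ.+ j ℕ.+ (3 ℕ.+ 5 ℕ.* n)
      reindex = ℕ-Solver.solve-∀
    pos-combination : ∀ a b c d → + (a ℕ.+ 2 ℕ.* b ℕ.+ 3 ℕ.* c ℕ.+ 4 ℕ.* d) ≡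
      + a + + 2 * + b + + 3 * + c + + 4 * + d
    pos-combination a b c d = cong₂ _+_ (cong₂ _+_ (cong (_+_ (+ a))
      (ℤₚ.pos-* 2 b)) (ℤₚ.pos-* 3 c)) (ℤₚ.pos-* 4 d)
    -- The weights 1, 2, 3, 4 grow linearly, so second differences cancel in the interior. The ends
    -- `p₁` and `p₆` sit at exponents congruent to 4 modulo 5, and `p₅` has coefficient 3 - 8 = -5.
    telescope : ∀ p₁ p₂ p₃ p₄ p₅ p₆ →
      (p₃ - + 2 * p₂ + p₁) + + 2 * (p₄ - + 2 * p₃ + p₂) +
      + 3 * (p₅ - + 2 * p₄ + p₃) + + 4 * (p₆ - + 2 * p₅ + p₄) ≡
      p₁ + (+ 4 * p₆ - + 5 * p₅)
    telescope = solve-∀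
    total : + (γ (5 ℕ.* suc n ℕ.+ 1) ℕ.+ 2 ℕ.* γ (5 ℕ.* suc n ℕ.+ 2) ℕ.+
               3 ℕ.* γ (5 ℕ.* suc n ℕ.+ 3) ℕ.+ 4 ℕ.* γ (5 ℕ.* suc n ℕ.+ 4)) ≡
      p (1 ℕ.+ e) + (+ 4 * p (6 ℕ.+ e) - + 5 * p (5 ℕ.+ e))
    total = begin
      _
        ≡⟨ pos-combination (γ (5 ℕ.* suc n ℕ.+ 1)) (γ (5 ℕ.* suc n ℕ.+ 2))
             (γ (5 ℕ.* suc n ℕ.+ 3)) (γ (5 ℕ.* suc n ℕ.+ 4)) ⟩
      + γ (5 ℕ.* suc n ℕ.+ 1) + + 2 * + γ (5 ℕ.* suc n ℕ.+ 2) +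
        + 3 * + γ (5 ℕ.* suc n ℕ.+ 3) + + 4 * + γ (5 ℕ.* suc n ℕ.+ 4)
        ≡⟨ cong₂ _+_ (cong₂ _+_ (cong₂ _+_
             (γ-at 0) (cong (_*_ (+ 2)) (γ-at 1)))
             (cong (_*_ (+ 3)) (γ-at 2))) (cong (_*_ (+ 4)) (γ-at 3)) ⟩
      _
        ≡⟨ telescope (p (1 ℕ.+ e)) (p (2 ℕ.+ e)) (p (3 ℕ.+ e))
             (p (4 ℕ.+ e)) (p (5 ℕ.+ e)) (p (6 ℕ.+ e)) ⟩
      p (1 ℕ.+ e) + (+ 4 * p (6 ℕ.+ e) - + 5 * p (5 ℕ.+ e)) ∎
      where
      γ-at : ∀ j → + γ (5 ℕ.* suc n ℕ.+ suc j) ≡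
        p (3 ℕ.+ (j ℕ.+ e)) - + 2 * p (2 ℕ.+ (j ℕ.+ e)) + p (1 ℕ.+ (j ℕ.+ e))
      γ-at j = trans (cong (λ i → + γ i) (index j)) (γ-p (j ℕ.+ e))

open import Data.Nat using (_+_; _*_)

mainTheorem8 : (n : ℕ) → 1 ≤ n →
    5 ∣ (γ (5 * n + 1) + 2 * γ (5 * n + 2) + 3 * γ (5 * n + 3) + 4 * γ (5 * n + 4))
mainTheorem8 (suc n) _ = ℤ∣.∣⇒∣ᵤ (5∣γ-combination n)
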